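{- Let $n=p_1p_2\cdots p_t\ge2$ be squarefree, where $p_1,\ldots,p_t$ are distinct primes. For any given $k\in\mathbb{N}$, the roots of $\Phi_n(z^k)$ are the nonzero components of the Kronecker product $$\vec\zeta_k\otimes(\vec\zeta_{p_1}^{\,*})^{\frac1k}\otimes\cdots\otimes(\vec\zeta_{p_t}^{\,*})^{\frac1k},$$ where $\vec\zeta_{p_j}^{\,*}:=(0,\zeta_{p_j},\zeta_{p_j}^2,\ldots,\zeta_{p_j}^{p_j-1})$.
   Context: $\mathbb{N}=\{1,2,\ldots\}$. $\Phi_n$ is the $n$th cyclotomic polynomial, $\zeta_n:=e^{2\pi i/n}$, and $\vec\zeta_k:=(1,\zeta_k,\ldots,\zeta_k^{k-1})\in\mathbb{C}^k$. The Kronecker product of $\vec x=(x_1,\ldots,x_a)\in\mathbb{C}^a$ and $\vec y=(y_1,\ldots,y_b)\in\mathbb{C}^b$ is $\vec x\otimes\vec y=(x_1\vec y,\ldots,x_a\vec y)\in\mathbb{C}^{ab}$, where $x_j\vec y=(x_jy_1,\ldots,x_jy_b)$. For $\vec\xi=(\xi_1,\ldots,\xi_r)\in\mathbb{C}^r$, $\vec\xi^{\,1/k}:=(\xi_1^{1/k},\ldots,\xi_r^{1/k})$, where for $y\in\mathbb{C}$, $y^{1/k}$ is the principal $k$th root $y^{1/k}=|y|^{1/k}e^{i\,\mathrm{Arg}(y)/k}$ with $-\pi<\mathrm{Arg}(y)\le\pi$ (and $0^{1/k}=0$). -}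

module Defs where

open import Algebra.Apartness.Structures using (IsHeytingField)
open import Algebra.Bundles using (RawRing; CommutativeRing; Semiring)
open import Algebra.Core using (Op₁; Op₂)
import Algebra.Definitions.RawSemiring as SemiringDefs
open import Data.Fin using (Fin; zero; suc; toℕ)
open import Data.List using (List; []; _∷_; foldr; map; filter; upTo)
open import Data.Nat as ℕ using (ℕ; zero; suc; _!)
open import Data.Nat.Coprimality using (coprime?)
open import Data.Product using (_×_; _,_; ∃; proj₁; proj₂)
open import Data.Product.Relation.Binary.Pointwise.NonDependent using (×-setoid)
open import Data.Sum using (_⊎_; inj₁; inj₂)
open import Data.Vec as Vec using (Vec)
import Data.Vec.Membership.Setoid as VecMembership
open import Data.Vec.Functional as Vector using (Vector)
open import Data.Vec.Relation.Binary.Pointwise.Inductive using (Pointwise)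
open import Level using (Level; _⊔_) renaming (suc to lsuc)
open import Relation.Binary.Bundles using (Setoid)
open import Relation.Binary.Core using (Rel)
open import Relation.Binary.Structures using (IsStrictPartialOrder)
open import Relation.Nullary using (¬_)

-- The real numbers, as an arbitrary Cauchy-complete Archimedean ordered
-- field.  Cotransitivity of < (x < y → x < z or z < y) is not a field: it
-- follows from cotransitivity of # and transitivity of <.
record RealNumbers c ℓ₁ ℓ₂ : Set (lsuc (c ⊔ ℓ₁ ⊔ ℓ₂)) where
  infix  8 -_
  infixl 7 _*_
  infixl 6 _+_
  infix  9 1/_
  infix  4 _≈_ _<_ _≤_ _#_ _⟶_
  field
    Carrier : Set c
    _≈_     : Rel Carrier ℓ₁
    _<_     : Rel Carrier ℓ₂
    _+_     : Op₂ Carrier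
    _*_     : Op₂ Carrier
    -_      : Op₁ Carrier
    0#      : Carrier
    1#      : Carrier

  _#_ : Rel Carrier ℓ₂
  x # y = x < y ⊎ y < x

  _≤_ : Rel Carrier ℓ₂
  x ≤ y = ¬ (y < x)

  field
    isHeytingField       : IsHeytingField _≈_ _#_ _+_ _*_ -_ 0# 1#
    isStrictPartialOrder : IsStrictPartialOrder _≈_ _<_
    +-monoˡ-<            : ∀ z {x y} → x < y → x + z < y + z
    *-positive           : ∀ {x y} → 0# < x → 0# < y → 0# < x * y
    0<1                  : 0# < 1#

  open IsHeytingField isHeytingField public
  open IsStrictPartialOrder isStrictPartialOrder public
    using (<-resp-≈) renaming (irrefl to <-irrefl; trans to <-trans)

  commutativeRing : CommutativeRing c ℓ₁
  commutativeRing = record { isCommutativeRing = isCommutativeRing }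

  open CommutativeRing commutativeRing public
    using (semiring)

  open SemiringDefs (Semiring.rawSemiring semiring) public
    using (_^_) renaming (_×_ to _·_)

  _⟶_ : (ℕ → Carrier) → Carrier → Set (c ⊔ ℓ₂)
  s ⟶ l = ∀ ε → 0# < ε → ∃ λ N → ∀ n → N ℕ.≤ n →
    (s n - l < ε) × (l - s n < ε)

  -- One inequality suffices, as m and n may be exchanged.
  Cauchy : (ℕ → Carrier) → Set (c ⊔ ℓ₂)
  Cauchy s = ∀ ε → 0# < ε → ∃ λ N → ∀ m n → N ℕ.≤ m → N ℕ.≤ n →
    s m - s n < ε

  field
    archimedean : ∀ x → ∃ λ n → x < n · 1#
    complete    : ∀ s → Cauchy s → ∃ λ l → s ⟶ l

  fromℕ : ℕ → Carrier
  fromℕ n = n · 1#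

  fromℕ-suc-positive : ∀ n → 0# < fromℕ (suc n)
  fromℕ-suc-positive zero    = proj₁ <-resp-≈ (sym (+-identityʳ 1#)) 0<1
  fromℕ-suc-positive (suc n) =
    <-trans 0<1
      (proj₂ <-resp-≈ (+-identityˡ 1#)
        (proj₁ <-resp-≈ (+-comm (fromℕ (suc n)) 1#)
          (+-monoˡ-< 1# (fromℕ-suc-positive n))))

  -- The value at 0 is junk; at suc n, #⇒invertible inverts the real number
  -- fromℕ (suc n) - 0#.
  1/_ : ℕ → Carrier
  1/ zero  = 0#
  1/ suc n = proj₁ (#⇒invertible (inj₂ (fromℕ-suc-positive n)))

module ComplexNumbers {c ℓ₁ ℓ₂} (R : RealNumbers c ℓ₁ ℓ₂) where

  infixl 6 _+ₚ_
  infixl 7 _*ₚ_ _⊗_ _⨂_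
  infix  4 _⟶_

  private module ℝ = RealNumbers R
  open ℝ using () renaming (Carrier to ℝ)

  ℂ : Set c
  ℂ = ℝ × ℝ

  re im : ℂ → ℝ
  re = proj₁
  im = proj₂

  ℂ-setoid : Setoid c ℓ₁
  ℂ-setoid = ×-setoid ℝ.setoid ℝ.setoid

  ℂ-rawRing : RawRing c ℓ₁
  ℂ-rawRing = record
    { Carrier = ℂ
    ; _≈_     = Setoid._≈_ ℂ-setoid
    ; _+_     = λ (a , b) (a′ , b′) → a ℝ.+ a′ , b ℝ.+ b′
    ; _*_     = λ (a , b) (a′ , b′) →
                  a ℝ.* a′ ℝ.- b ℝ.* b′ , a ℝ.* b′ ℝ.+ b ℝ.* a′
    ; -_      = λ (a , b) → ℝ.- a , ℝ.- b
    ; 0#      = ℝ.0# , ℝ.0#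
    ; 1#      = ℝ.1# , ℝ.0#
    }

  open RawRing ℂ-rawRing public
    using (_≈_; _+_; _*_; -_; rawSemiring) renaming (0# to 0ℂ; 1# to 1ℂ)
  open SemiringDefs rawSemiring public using (_^_; sum)
  open VecMembership ℂ-setoid public using (_∈_)

  ofReal : ℝ → ℂ
  ofReal x = x , ℝ.0#

  i·_ : ℝ → ℂ
  i· θ = ℝ.0# , θ

  _⟶_ : (ℕ → ℂ) → ℂ → Set (c ⊔ ℓ₂)
  s ⟶ l = ((λ n → re (s n)) ℝ.⟶ re l) × ((λ n → im (s n)) ℝ.⟶ im l)

  expTerm : ℂ → ℕ → ℂ
  expTerm z j = z ^ j * ofReal (ℝ.1/ (j !))

  -- exp is the sum of its power series.  Limits are unique and real Cauchy
  -- sequences converge, so there is exactly one such function up to ≈.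
  IsExp : (ℂ → ℂ) → Set (c ⊔ ℓ₂)
  IsExp exp = ∀ z → (λ n → sum {n} (λ j → expTerm z (toℕ j))) ⟶ exp z

  -- π is the least positive zero of sin θ = im (exp (iθ)).
  record IsPi (exp : ℂ → ℂ) (π : ℝ) : Set (c ⊔ ℓ₁ ⊔ ℓ₂) where
    field
      positive : ℝ.0# ℝ.< π
      zero-sin : im (exp (i· π)) ℝ.≈ ℝ.0#
      least    : ∀ θ → ℝ.0# ℝ.< θ → θ ℝ.< π → im (exp (i· θ)) ℝ.# ℝ.0#

  -- Polynomials are lists of coefficients, constant term first.
  Poly : Set c
  Poly = List ℂ

  _+ₚ_ : Poly → Poly → Poly
  []      +ₚ q       = q
  (a ∷ p) +ₚ []      = a ∷ p
  (a ∷ p) +ₚ (b ∷ q) = (a + b) ∷ (p +ₚ q)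

  _*ₚ_ : Poly → Poly → Poly
  []      *ₚ q = []
  (a ∷ p) *ₚ q = map (a *_) q +ₚ (0ℂ ∷ p *ₚ q)

  eval : Poly → ℂ → ℂ
  eval p z = foldr (λ a v → a + z * v) 0ℂ p

  _⊗_ : ∀ {a b} → Vec ℂ a → Vec ℂ b → Vec ℂ (a ℕ.* b)
  x ⊗ y = Vec.concat (Vec.map (λ xⱼ → Vec.map (xⱼ *_) y) x)

  -- x ⨂ (v₁ , … , vₜ)  =  (⋯ ((x ⊗ v₁) ⊗ v₂) ⋯) ⊗ vₜ
  _⨂_ : ∀ {a t} {d : Vector ℕ t} → Vec ℂ a → (∀ j → Vec ℂ (d j)) →
        Vec ℂ (Vector.foldl ℕ._*_ a d)
  _⨂_ {t = zero}  x v = x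
  _⨂_ {t = suc t} x v = (x ⊗ v zero) ⨂ (λ j → v (suc j))

  module RootsOfUnity (exp : ℂ → ℂ) (π : ℝ) where

    -- ζ n = exp (2πi / n)
    ζ : ℕ → ℂ
    ζ n = exp (i· ((π ℝ.+ π) ℝ.* ℝ.1/ n))

    ζ⃗ : ∀ k → Vec ℂ k
    ζ⃗ k = Vec.tabulate (λ j → ζ k ^ toℕ j)

    -- The entry of index 0 is 0 rather than ζ p ^ 0.
    ζ*-entry : ∀ p → Fin p → ℂ
    ζ*-entry p zero      = 0ℂ
    ζ*-entry p j@(suc _) = ζ p ^ toℕ j

    ζ⃗* : ∀ p → Vec ℂ p
    ζ⃗* p = Vec.tabulate (ζ*-entry p)

    -- Φ n is the product of X - ζ n ^ j over 0 ≤ j < n with j coprime to n.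
    Φ : ℕ → Poly
    Φ n = foldr _*ₚ_ (1ℂ ∷ [])
            (map (λ j → - (ζ n ^ j) ∷ 1ℂ ∷ [])
                 (filter (λ j → coprime? j n) (upTo n)))

    -- w = y^(1/k) for the principal kth root (k ≥ 1): the fields say
    -- modulus = |y|, arg = Arg y, rootModulus = |y|^(1/k).  A relation rather
    -- than a function, because Arg jumps across the negative real axis and so
    -- is not constructively a total function; w is still determined by y.
    -- For y = 0, arg is unconstrained within (-π, π] and w = 0.
    record IsPrincipalRoot (k : ℕ) (y w : ℂ) : Set (c ⊔ ℓ₁ ⊔ ℓ₂) where
      field
        modulus rootModulus arg : ℝ
        modulus-nonneg     : ℝ.0# ℝ.≤ modulus
        modulus²           : modulus ℝ.* modulus
                               ℝ.≈ re y ℝ.* re y ℝ.+ im y ℝ.* im y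
        -π<arg             : ℝ.- π ℝ.< arg
        arg≤π              : arg ℝ.≤ π
        polar              : y ≈ ofReal modulus * exp (i· arg)
        rootModulus-nonneg : ℝ.0# ℝ.≤ rootModulus
        rootModulus^k      : rootModulus ℝ.^ k ℝ.≈ modulus
        root               : w ≈ ofReal rootModulus * exp (i· (arg ℝ.* ℝ.1/ k))

    IsPrincipalRootVec : ℕ → ∀ {r} → Vec ℂ r → Vec ℂ r → Set (c ⊔ ℓ₁ ⊔ ℓ₂)
    IsPrincipalRootVec k ξ w = Pointwise (IsPrincipalRoot k) ξ w

{-# OPTIONS --safe #-}

-- A principal kth root w of y satisfies w ^ k = y, and this is all that the
-- proof uses of it.  By the Chinese remainder theorem the primitive nth roots of
-- unity are the products of one entry ζ p ^ m, 0 < m < p, for each prime p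
-- dividing n.  Hence the nonzero products of one entry from each vector v j are
-- kth roots u of the roots of Φ n, one for each of them, and the other kth roots
-- are the products ζ k ^ a * u.  Constructively, a point z at which a product of
-- factors z - x vanishes equals one of the roots x because these are pairwise
-- apart: z is then apart from all of them but at most one.
--
-- The roots of unity come from exp (w + z) = exp w * exp z.  The Cauchy product
-- of the two series differs from the product of their nth partial sums by at most
-- the terms from n to 2n of the real exponential series at r + s, where r and s
-- bound w and z.

module Submission where

open import Defs
open import Algebra.Apartness.Bundles using (HeytingCommutativeRing; HeytingField)
import Algebra.Apartness.Properties.HeytingCommutativeRing as HeytingProperties
open import Algebra.Bundles using (AbelianGroup; CommutativeRing; Semiring)
import Algebra.Construct.DirectProduct as DirectProduct
import Algebra.Definitions.RawSemiring as SemiringDefs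
import Algebra.Properties.AbelianGroup as AbelianGroupProperties
import Algebra.Properties.CommutativeSemiring.Exp as CommutativeExp
import Algebra.Properties.Group as GroupProperties
import Algebra.Properties.Monoid.Mult as Mult
import Algebra.Properties.Ring as RingProperties
import Algebra.Properties.Semiring.Exp as Exp
import Algebra.Properties.Semiring.Mult as SemiringMult
import Algebra.Properties.Semiring.Mult.TCOptimised as OptimisedMult
import Algebra.Solver.Ring as RingSolver
open import Algebra.Solver.Ring.AlmostCommutativeRing
  using (fromCommutativeRing; _-Raw-AlmostCommutative⟶_)
open import Data.Fin as Fin using (Fin; toℕ)
import Data.Fin.Properties as Fin
open import Data.Integer as ℤ using (ℤ; +_; -[1+_]; 0ℤ; 1ℤ; _◃_; _⊖_)
import Data.Integer.Properties as ℤ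
open import Data.List as List using (List; []; _∷_; length)
import Data.List.Membership.Propositional as Membership
import Data.List.Membership.Propositional.Properties as Membership
import Data.List.Properties as List
open import Data.List.Relation.Unary.All as All using (All; []; _∷_)
import Data.List.Relation.Unary.All.Properties as All
open import Data.List.Relation.Unary.AllPairs as AllPairs using (AllPairs; []; _∷_)
import Data.List.Relation.Unary.AllPairs.Properties as AllPairs
open import Data.List.Relation.Unary.Any as Any using (Any; here; there)
import Data.List.Relation.Unary.Any.Properties as Any
open import Data.Maybe using (Maybe; just; nothing)
open import Data.Nat as ℕ using (ℕ; zero; suc; _!)
open import Data.Nat.Coprimality as Coprimality
  using (Coprime; coprime?; coprime-Bézout; coprime-divisor; prime⇒coprime)
open import Data.Nat.Divisibility as ∣ using (_∣_)
import Data.Nat.DivMod as DivMod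
open import Data.Nat.GCD using (module Bézout)
open import Data.Nat.Primality
  using (Prime; prime⇒irreducible; euclidsLemma; ¬prime[1]; prime⇒nonZero)
import Data.Nat.Properties as ℕ
import Data.Nat.Solver as ℕSolver
open import Data.Product using (_×_; _,_; ∃; ∃₂; proj₁; proj₂; uncurry)
open import Data.Sign as Sign using (Sign)
open import Data.Sum using (_⊎_; inj₁; inj₂; [_,_]′; swap)
open import Data.Vec as Vec using (Vec; []; _∷_)
open import Data.Vec.Functional using (Vector; foldr)
import Data.Vec.Properties as Vec
import Data.Vec.Relation.Binary.Pointwise.Inductive as Pointwise
import Data.Vec.Relation.Unary.Any as VecAny
import Data.Vec.Relation.Unary.Any.Properties as VecAny
open import Function using (_∘_)
open import Function.Bundles using (_⇔_; mk⇔)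
open import Function.Definitions using (Injective)
open import Level using (_⊔_)
open import Relation.Binary.Definitions using (Asymmetric)
open import Relation.Binary.PropositionalEquality as ≡ using (_≡_; _≢_)
import Relation.Binary.Reasoning.Base.Triple as TripleReasoning
import Relation.Binary.Reasoning.Setoid as SetoidReasoning
open import Relation.Binary.Structures using (IsPreorder)
open import Relation.Nullary using (¬_; contradiction; yes; no)

-- Equality and order of real numbers are undecidable here, and the proof is arranged so that no
-- step decides them. Which entries of `ζ⃗* p` vanish is read off from indices, the position of the
-- angle 2πj/p relative to π from a comparison of natural numbers, and a root is located among its
-- candidates by apartness alone. For this the powers of `ζ n` below n must be shown pairwise apart,
-- not merely distinct.
--
-- The function `exp` is known only as the pointwise limit of its partial sums. Its compatibility
-- with `≈` has to be derived, and the convergence of the real majorant is taken from the same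
-- hypothesis at a real argument instead of being estimated. π enters through sin π = 0 and the
-- apartness of sin from 0 on (0, π): halving π gives exp (iπ) = -1, and the double-angle formula at
-- jπ/n separates `ζ n ^ j` from 1.
--
-- Since the principal root is a relation, the existence of the root vectors is a separate claim,
-- proved from explicit polar coordinates of the entries.

-- Integer coefficients let the ring solver recognise x - x as 0#.
module IntegerCoefficients {c ℓ} (R : CommutativeRing c ℓ) where
  open CommutativeRing R
  open RingProperties ring
    using (-‿distribˡ-*; -‿distribʳ-*; -‿involutive; -0#≈0#)
  open AbelianGroupProperties +-abelianGroup using (⁻¹-∙-comm)
  -- For this multiple 1 · x is x by definition, so `con 1ℤ` denotes `1#` itself and not `1# + 0#`.
  open OptimisedMult semiring renaming (_×_ to _·_)
  open SetoidReasoning setoid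

  private
    ⟦_⟧ : ℤ → Carrier
    ⟦ + n      ⟧ = n · 1#
    ⟦ -[1+ n ] ⟧ = - (suc n · 1#)

    ⊖-homo : ∀ m n → ⟦ m ⊖ n ⟧ ≈ m · 1# - n · 1#
    ⊖-homo m       zero    = sym (trans (+-congˡ -0#≈0#) (+-identityʳ _))
    ⊖-homo zero    (suc n) = sym (+-identityˡ _)
    ⊖-homo (suc m) (suc n) = begin
      ⟦ suc m ⊖ suc n ⟧                 ≡⟨ ≡.cong ⟦_⟧ (ℤ.[1+m]⊖[1+n]≡m⊖n m n) ⟩
      ⟦ m ⊖ n ⟧                         ≈⟨ ⊖-homo m n ⟩
      m · 1# - n · 1#                   ≈⟨ +-congʳ (+-identityʳ _) ⟨
      m · 1# + 0# - n · 1#              ≈⟨ +-congʳ (+-congˡ (-‿inverseʳ 1#)) ⟨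
      m · 1# + (1# - 1#) - n · 1#       ≈⟨ +-congʳ (+-assoc _ _ _) ⟨
      m · 1# + 1# - 1# - n · 1#         ≈⟨ +-assoc _ _ _ ⟩
      m · 1# + 1# + (- 1# - n · 1#)     ≈⟨ +-cong (+-comm _ _) (⁻¹-∙-comm _ _) ⟩
      1# + m · 1# - (1# + n · 1#)       ≈⟨ +-cong (1+× m 1#) (-‿cong (1+× n 1#)) ⟨
      suc m · 1# - suc n · 1#           ∎

    +-homo : ∀ i j → ⟦ i ℤ.+ j ⟧ ≈ ⟦ i ⟧ + ⟦ j ⟧
    +-homo (+ m)    (+ n)    = ×-homo-+ 1# m n
    +-homo (+ m)    -[1+ n ] = ⊖-homo m (suc n)
    +-homo -[1+ m ] (+ n)    = trans (⊖-homo n (suc m)) (+-comm _ _)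
    +-homo -[1+ m ] -[1+ n ] = begin
      - (suc (suc (m ℕ.+ n)) · 1#)      ≡⟨ ≡.cong (λ k → - (suc k · 1#)) (ℕ.+-suc m n) ⟨
      - ((suc m ℕ.+ suc n) · 1#)        ≈⟨ -‿cong (×-homo-+ 1# (suc m) (suc n)) ⟩
      - (suc m · 1# + suc n · 1#)       ≈⟨ ⁻¹-∙-comm _ _ ⟨
      - (suc m · 1#) - suc n · 1#       ∎

    signed : Sign → Carrier → Carrier
    signed Sign.+ x = x
    signed Sign.- x = - x

    signed-cong : ∀ s {x y} → x ≈ y → signed s x ≈ signed s y
    signed-cong Sign.+ x≈y = x≈y
    signed-cong Sign.- x≈y = -‿cong x≈y

    signed-* : ∀ s t x y → signed (s Sign.* t) (x * y) ≈ signed s x * signed t y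
    signed-* Sign.+ Sign.+ x y = refl
    signed-* Sign.+ Sign.- x y = -‿distribʳ-* x y
    signed-* Sign.- Sign.+ x y = -‿distribˡ-* x y
    signed-* Sign.- Sign.- x y = begin
      x * y         ≈⟨ -‿involutive _ ⟨
      - - (x * y)   ≈⟨ -‿cong (-‿distribˡ-* x y) ⟩
      - (- x * y)   ≈⟨ -‿distribʳ-* _ y ⟩
      - x * - y     ∎

    ◃-homo : ∀ s n → ⟦ s ◃ n ⟧ ≈ signed s (n · 1#)
    ◃-homo Sign.+ zero    = refl
    ◃-homo Sign.- zero    = sym -0#≈0#
    ◃-homo Sign.+ (suc n) = refl
    ◃-homo Sign.- (suc n) = refl

    ⟦⟧≈signed : ∀ i → ⟦ i ⟧ ≈ signed (ℤ.sign i) (ℤ.∣ i ∣ · 1#)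
    ⟦⟧≈signed (+ n)    = refl
    ⟦⟧≈signed -[1+ n ] = refl

    *-homo : ∀ i j → ⟦ i ℤ.* j ⟧ ≈ ⟦ i ⟧ * ⟦ j ⟧
    *-homo i j = begin
      ⟦ i ℤ.* j ⟧                                   ≈⟨ ◃-homo s (a ℕ.* b) ⟩
      signed s ((a ℕ.* b) · 1#)                     ≈⟨ signed-cong s (×1-homo-* a b) ⟩
      signed s (a · 1# * (b · 1#))                  ≈⟨ signed-* (ℤ.sign i) (ℤ.sign j) _ _ ⟩
      signed (ℤ.sign i) (a · 1#) * signed (ℤ.sign j) (b · 1#)
                                                    ≈⟨ *-cong (⟦⟧≈signed i) (⟦⟧≈signed j) ⟨
      ⟦ i ⟧ * ⟦ j ⟧                                 ∎
      where
      s = ℤ.sign i Sign.* ℤ.sign j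
      a = ℤ.∣ i ∣
      b = ℤ.∣ j ∣

    -‿homo : ∀ i → ⟦ ℤ.- i ⟧ ≈ - ⟦ i ⟧
    -‿homo (+ zero)  = sym -0#≈0#
    -‿homo (+ suc n) = refl
    -‿homo -[1+ n ]  = sym (-‿involutive _)

    homomorphism : ℤ.+-*-rawRing -Raw-AlmostCommutative⟶ fromCommutativeRing R
    homomorphism = record
      { ⟦_⟧    = ⟦_⟧
      ; +-homo = +-homo
      ; *-homo = *-homo
      ; -‿homo = -‿homo
      ; 0-homo = refl
      ; 1-homo = refl
      }

    _≟_ : ∀ i j → Maybe (⟦ i ⟧ ≈ ⟦ j ⟧)
    i ≟ j with i ℤ.≟ j
    ... | yes ≡.refl = just refl
    ... | no  _      = nothing

  open RingSolver ℤ.+-*-rawRing (fromCommutativeRing R) homomorphism _≟_ public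
    using (solve; _:=_; _:+_; _:*_; _:-_; :-_; con)

-- Cauchy products and their partial sums.

module Convolution {c ℓ} (R : CommutativeRing c ℓ) where
  open CommutativeRing R
  open SemiringDefs (Semiring.rawSemiring semiring) using (sum)
  open Mult +-monoid using () renaming (_×_ to _·_)
  open IntegerCoefficients R
  open SetoidReasoning setoid

  Sequence : Set c
  Sequence = ℕ → Carrier

  Σ< : Sequence → ℕ → Carrier
  Σ< f n = sum {n} (f ∘ toℕ)

  Σ<-cong : ∀ {f g : Sequence} → (∀ i → f i ≈ g i) → ∀ n → Σ< f n ≈ Σ< g n
  Σ<-cong f≈g zero    = refl
  Σ<-cong f≈g (suc n) = +-cong (f≈g 0) (Σ<-cong (f≈g ∘ suc) n)

  Σ<-suc : ∀ f n → Σ< f (suc n) ≈ Σ< f n + f n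
  Σ<-suc f zero    = +-comm _ _
  Σ<-suc f (suc n) = trans (+-congˡ (Σ<-suc (f ∘ suc) n)) (sym (+-assoc _ _ _))

  -- The coefficient of the Cauchy product, that is, the sum of `f i * g j` over i + j = n.
  -- Recursion on the first sequence avoids the index n - i.
  conv : Sequence → Sequence → Sequence
  conv f g zero    = f 0 * g 0
  conv f g (suc n) = f 0 * g (suc n) + conv (f ∘ suc) g n

  conv-cong : ∀ {f f′ g g′} → (∀ i → f i ≈ f′ i) → (∀ i → g i ≈ g′ i) →
              ∀ n → conv f g n ≈ conv f′ g′ n
  conv-cong f≈ g≈ zero    = *-cong (f≈ 0) (g≈ 0)
  conv-cong f≈ g≈ (suc n) =
    +-cong (*-cong (f≈ 0) (g≈ (suc n))) (conv-cong (f≈ ∘ suc) g≈ n)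

  conv-*ˡ : ∀ a f g n → conv (λ i → a * f i) g n ≈ a * conv f g n
  conv-*ˡ a f g zero    = *-assoc _ _ _
  conv-*ˡ a f g (suc n) =
    trans (+-cong (*-assoc _ _ _) (conv-*ˡ a (f ∘ suc) g n)) (sym (distribˡ _ _ _))

  conv-*ʳ : ∀ a f g n → conv f (λ i → a * g i) n ≈ a * conv f g n
  conv-*ʳ a f g zero    = solve 3 (λ a x y → x :* (a :* y) := a :* (x :* y)) refl a _ _
  conv-*ʳ a f g (suc n) = begin
    f 0 * (a * g (suc n)) + conv (f ∘ suc) (λ i → a * g i) n
      ≈⟨ +-congˡ (conv-*ʳ a (f ∘ suc) g n) ⟩
    f 0 * (a * g (suc n)) + a * conv (f ∘ suc) g n
      ≈⟨ solve 4 (λ a x y z → x :* (a :* y) :+ a :* z := a :* (x :* y :+ z)) refl a _ _ _ ⟩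
    a * conv f g (suc n) ∎

  conv-suc : ∀ f g n → conv f g (suc n) ≈ conv f (g ∘ suc) n + f (suc n) * g 0
  conv-suc f g zero    = refl
  conv-suc f g (suc n) = trans (+-congˡ (conv-suc (f ∘ suc) g n)) (sym (+-assoc _ _ _))

  -- Every term f i * g j of the convolution at n has i + j = n.
  conv-weighted : ∀ f g w n →
    conv (λ i → (w + i · 1#) * f i) g n + conv f (λ j → j · 1# * g j) n
      ≈ (w + n · 1#) * conv f g n
  conv-weighted f g w zero    =
    solve 3 (λ w x y → (w :+ con 0ℤ) :* x :* y :+ x :* (con 0ℤ :* y)
                         := (w :+ con 0ℤ) :* (x :* y)) refl w (f 0) (g 0)
  conv-weighted f g w (suc n) = begin
    (w + 0#) * f 0 * g (suc n) + conv (λ i → (w + suc i · 1#) * f (suc i)) g n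
      + (f 0 * (suc n · 1# * g (suc n)) + conv (f ∘ suc) (λ j → j · 1# * g j) n)
      -- Once the head is split off, the tail of `f` is indexed from 0 again. The offset `w` is
      -- there to absorb this shift: the induction runs with `w + 1#`.
      ≈⟨ +-congʳ (+-congˡ (conv-cong (λ i → *-congʳ (sym (+-assoc w 1# (i · 1#)))) (λ _ → refl) n)) ⟩
    (w + 0#) * f 0 * g (suc n) + conv (λ i → (w + 1# + i · 1#) * f (suc i)) g n
      + (f 0 * (suc n · 1# * g (suc n)) + conv (f ∘ suc) (λ j → j · 1# * g j) n)
      ≈⟨ solve 6 (λ w s x y u v →
           (w :+ con 0ℤ) :* x :* y :+ u :+ (x :* (s :* y) :+ v)
             := (w :+ s) :* (x :* y) :+ (u :+ v)) refl
           w (suc n · 1#) (f 0) (g (suc n)) _ _ ⟩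
    (w + suc n · 1#) * (f 0 * g (suc n))
      + (conv (λ i → (w + 1# + i · 1#) * f (suc i)) g n + conv (f ∘ suc) (λ j → j · 1# * g j) n)
      ≈⟨ +-congˡ (conv-weighted (f ∘ suc) g (w + 1#) n) ⟩
    (w + suc n · 1#) * (f 0 * g (suc n)) + (w + 1# + n · 1#) * conv (f ∘ suc) g n
      ≈⟨ solve 4 (λ w m x y → (w :+ (con 1ℤ :+ m)) :* x :+ (w :+ con 1ℤ :+ m) :* y
           := (w :+ (con 1ℤ :+ m)) :* (x :+ y)) refl w (n · 1#) _ _ ⟩
    (w + suc n · 1#) * conv f g (suc n) ∎

  -- tri f g n is the sum of f i * g j over i + j < n.
  tri : Sequence → Sequence → ℕ → Carrier
  tri f g zero    = 0#
  tri f g (suc n) = f 0 * Σ< g (suc n) + tri (f ∘ suc) g n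

  tri-suc : ∀ f g n → tri f g (suc n) ≈ tri f g n + conv f g n
  tri-suc f g zero    =
    solve 2 (λ x y → x :* (y :+ con 0ℤ) :+ con 0ℤ := con 0ℤ :+ x :* y) refl (f 0) (g 0)
  tri-suc f g (suc n) = begin
    f 0 * Σ< g (suc (suc n)) + tri (f ∘ suc) g (suc n)
      ≈⟨ +-cong (*-congˡ (Σ<-suc g (suc n))) (tri-suc (f ∘ suc) g n) ⟩
    f 0 * (Σ< g (suc n) + g (suc n)) + (tri (f ∘ suc) g n + conv (f ∘ suc) g n)
      ≈⟨ solve 5 (λ x s y t u → x :* (s :+ y) :+ (t :+ u) := x :* s :+ t :+ (x :* y :+ u)) refl
           (f 0) (Σ< g (suc n)) (g (suc n)) (tri (f ∘ suc) g n) (conv (f ∘ suc) g n) ⟩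
    tri f g (suc n) + conv f g (suc n) ∎

  tri≈Σ<conv : ∀ f g n → tri f g n ≈ Σ< (conv f g) n
  tri≈Σ<conv f g zero    = refl
  tri≈Σ<conv f g (suc n) = begin
    tri f g (suc n)                  ≈⟨ tri-suc f g n ⟩
    tri f g n + conv f g n           ≈⟨ +-congʳ (tri≈Σ<conv f g n) ⟩
    Σ< (conv f g) n + conv f g n     ≈⟨ Σ<-suc (conv f g) n ⟨
    Σ< (conv f g) (suc n)            ∎

  -- This identity and the next two are stated over any ring because the inductions for the error
  -- bounds apply each of them twice, to the complex series and to its real majorant.
  Σ<-suc-- : ∀ f m n →
             Σ< f (suc n) - Σ< f (suc m) ≈ Σ< (f ∘ suc) n - Σ< (f ∘ suc) m
  Σ<-suc-- f m n = solve 3 (λ x s t → x :+ s :- (x :+ t) := s :- t) refl (f 0) _ _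

  Σ<*Σ<-tri-suc : ∀ f g m n →
    Σ< f (suc m) * Σ< g n - tri f g (suc m)
      ≈ f 0 * (Σ< g n - Σ< g (suc m)) + (Σ< (f ∘ suc) m * Σ< g n - tri (f ∘ suc) g m)
  Σ<*Σ<-tri-suc f g m n =
    solve 5 (λ x s g₁ g₂ t → (x :+ s) :* g₁ :- (x :* g₂ :+ t) := x :* (g₁ :- g₂) :+ (s :* g₁ :- t)) refl
      (f 0) _ _ (Σ< g (suc m)) _

  0*x-0≈0 : ∀ x → 0# * x - 0# ≈ 0#
  0*x-0≈0 = solve 1 (λ x → con 0ℤ :* x :- con 0ℤ := con 0ℤ) refl

-- The formal exponential series.

-- An interface for the algebra shared by the real and the complex series. Division by n + 1 is
-- expressed as cancellation, which over ℂ can be checked on each coordinate.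
record InverseFactorials {c ℓ} (R : CommutativeRing c ℓ) : Set (c ⊔ ℓ) where
  open CommutativeRing R
  open Mult +-monoid using () renaming (_×_ to _·_)
  field
    1/_!      : ℕ → Carrier
    1/0!≈1    : 1/ 0 ! ≈ 1#
    1/[1+n]!  : ∀ n → suc n · 1# * 1/ (suc n) ! ≈ 1/ n !
    ·-cancelˡ : ∀ n {x y} → suc n · 1# * x ≈ suc n · 1# * y → x ≈ y

module ExponentialSeries {c ℓ} (R : CommutativeRing c ℓ) (F : InverseFactorials R) where
  open CommutativeRing R
  open Mult +-monoid using () renaming (_×_ to _·_)
  open InverseFactorials F
  open Convolution R
  open Exp semiring using (_^_)
  open IntegerCoefficients R
  open SetoidReasoning setoid

  term : Carrier → Sequence
  term x n = x ^ n * 1/ n !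

  term-suc : ∀ x n → suc n · 1# * term x (suc n) ≈ x * term x n
  term-suc x n = begin
    suc n · 1# * (x ^ suc n * 1/ (suc n) !)
      ≈⟨ solve 4 (λ s x p q → s :* (x :* p :* q) := x :* (p :* (s :* q))) refl _ _ _ _ ⟩
    x * (x ^ n * (suc n · 1# * 1/ (suc n) !))
      ≈⟨ *-congˡ (*-congˡ (1/[1+n]! n)) ⟩
    x * term x n ∎

  -- Binomial coefficients are avoided: both sides satisfy the recurrence (n + 1) a(n + 1) = (x + y)
  -- a(n). For the convolution this is the Leibniz rule: `conv-weighted` splits the factor n + 1
  -- over the two series, and `term-suc` turns each part into a shift.
  conv-term : ∀ x y n → conv (term x) (term y) n ≈ term (x + y) n
  conv-term x y zero    = begin
    1# * 1/ 0 ! * (1# * 1/ 0 !)    ≈⟨ *-congʳ (trans (*-congˡ 1/0!≈1) (*-identityˡ _)) ⟩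
    1# * (1# * 1/ 0 !)             ≈⟨ *-identityˡ _ ⟩
    1# * 1/ 0 !                    ∎
  conv-term x y (suc n) = ·-cancelˡ n (begin
    suc n · 1# * conv (term x) (term y) (suc n)
      ≈⟨ *-congʳ (+-identityˡ _) ⟨
    (0# + suc n · 1#) * conv (term x) (term y) (suc n)
      ≈⟨ conv-weighted (term x) (term y) 0# (suc n) ⟨
    conv (λ i → (0# + i · 1#) * term x i) (term y) (suc n)
      + conv (term x) (λ j → j · 1# * term y j) (suc n)
      ≈⟨ +-cong leftPart rightPart ⟩
    x * conv (term x) (term y) n + y * conv (term x) (term y) n
      ≈⟨ distribʳ _ _ _ ⟨
    (x + y) * conv (term x) (term y) n
      ≈⟨ *-congˡ (conv-term x y n) ⟩
    (x + y) * term (x + y) n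
      ≈⟨ term-suc (x + y) n ⟨
    suc n · 1# * term (x + y) (suc n) ∎)
    where
    leftPart : conv (λ i → (0# + i · 1#) * term x i) (term y) (suc n)
                 ≈ x * conv (term x) (term y) n
    leftPart = begin
      (0# + 0#) * term x 0 * term y (suc n)
        + conv (λ i → (0# + suc i · 1#) * term x (suc i)) (term y) n
        ≈⟨ +-cong
             (solve 2 (λ a b → (con 0ℤ :+ con 0ℤ) :* a :* b := con 0ℤ) refl _ _)
             (conv-cong (λ i → trans (*-congʳ (+-identityˡ _)) (term-suc x i)) (λ _ → refl) n) ⟩
      0# + conv (λ i → x * term x i) (term y) n
        ≈⟨ +-identityˡ _ ⟩
      conv (λ i → x * term x i) (term y) n
        ≈⟨ conv-*ˡ x (term x) (term y) n ⟩
      x * conv (term x) (term y) n ∎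

    rightPart : conv (term x) (λ j → j · 1# * term y j) (suc n)
                  ≈ y * conv (term x) (term y) n
    rightPart = begin
      conv (term x) (λ j → j · 1# * term y j) (suc n)
        ≈⟨ conv-suc (term x) _ n ⟩
      conv (term x) (λ j → suc j · 1# * term y (suc j)) n + term x (suc n) * (0# * term y 0)
        ≈⟨ +-cong (conv-cong (λ _ → refl) (term-suc y) n)
             (solve 2 (λ a b → a :* (con 0ℤ :* b) := con 0ℤ) refl _ _) ⟩
      conv (term x) (λ j → y * term y j) n + 0#
        ≈⟨ +-identityʳ _ ⟩
      conv (term x) (λ j → y * term y j) n
        ≈⟨ conv-*ʳ y (term x) (term y) n ⟩
      y * conv (term x) (term y) n ∎

  tri-term : ∀ x y n → tri (term x) (term y) n ≈ Σ< (term (x + y)) n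
  tri-term x y n = trans (tri≈Σ<conv (term x) (term y) n) (Σ<-cong (conv-term x y) n)

-- Apartness and roots of polynomials in a Heyting field.

module HeytingFieldProperties {c ℓ₁ ℓ₂} (F : HeytingField c ℓ₁ ℓ₂) where
  open HeytingField F
  open HeytingCommutativeRing heytingCommutativeRing using (commutativeRing) public
  open CommutativeRing commutativeRing using (semiring; +-group)
  open HeytingProperties heytingCommutativeRing public
  open GroupProperties +-group using (x∙y⁻¹≈ε⇒x≈y)
  open Exp semiring using (_^_)
  open IntegerCoefficients commutativeRing
  open SetoidReasoning setoid

  inverse : ∀ {x} → x # 0# → ∃ λ y → x * y ≈ 1#
  inverse x#0 with #⇒invertible x#0
  ... | y , _ , xy≈1 = y , trans (*-congʳ (sym (x-0≈x _))) xy≈1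

  inverse⇒#0 : ∀ {x y} → x * y ≈ 1# → x # 0#
  inverse⇒#0 xy≈1 = invertibleʳ⇒# (_ , trans (*-congʳ (x-0≈x _)) xy≈1)

  x*y#0⇒x#0 : ∀ {x y} → x * y # 0# → x # 0#
  x*y#0⇒x#0 xy#0 = inverse⇒#0 (trans (sym (*-assoc _ _ _)) (proj₂ (inverse xy#0)))

  x*y#0⇒y#0 : ∀ {x y} → x * y # 0# → y # 0#
  x*y#0⇒y#0 xy#0 = x*y#0⇒x#0 (#-congʳ (*-comm _ _) xy#0)

  -- By cotransitivity at `y`, either `y # 0#` or `x + y # y`; in the second case the inverse of
  -- `x + y - y` is an inverse of `x`.
  x+y#0⇒x#0⊎y#0 : ∀ {x y} → x + y # 0# → x # 0# ⊎ y # 0#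
  x+y#0⇒x#0⊎y#0 {x} {y} x+y#0 with #-cotrans x+y#0 y
  ... | inj₂ y#0   = inj₂ y#0
  ... | inj₁ x+y#y = inj₁ (inverse⇒#0 (begin
    x * z                  ≈⟨ solve 3 (λ x y z → x :* z := (x :+ y :- y) :* z) refl x y z ⟩
    (x + y - y) * z        ≈⟨ proj₂ (proj₂ (#⇒invertible x+y#y)) ⟩
    1#                     ∎))
    where z = proj₁ (#⇒invertible x+y#y)

  -#0 : ∀ {x} → x # 0# → - x # 0#
  -#0 {x} x#0 with inverse x#0
  ... | y , xy≈1 = inverse⇒#0
    (trans (solve 2 (λ x y → (:- x) :* (:- y) := x :* y) refl x y) xy≈1)

  #⇒-#0 : ∀ {x y} → x # y → x - y # 0#
  #⇒-#0 x#y = inverse⇒#0 (proj₂ (proj₂ (#⇒invertible x#y)))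

  -#0⇒# : ∀ {x y} → x - y # 0# → x # y
  -#0⇒# x-y#0 = invertibleʳ⇒# (inverse x-y#0)

  #⇒≉ : ∀ {x y} → x # y → ¬ x ≈ y
  #⇒≉ x#y x≈y = #-irrefl x≈y x#y

  ¬#⇒≈ : ∀ {x y} → ¬ x # y → x ≈ y
  ¬#⇒≈ = proj₁ (tight _ _)

  *-cancelˡ : ∀ {x y z} → x # 0# → x * y ≈ x * z → y ≈ z
  *-cancelˡ {x} {y} {z} x#0 xy≈xz with inverse x#0
  ... | w , xw≈1 = begin
    y              ≈⟨ *-identityˡ y ⟨
    1# * y         ≈⟨ *-congʳ xw≈1 ⟨
    x * w * y      ≈⟨ solve 3 (λ x w y → x :* w :* y := w :* (x :* y)) refl x w y ⟩
    w * (x * y)    ≈⟨ *-congˡ xy≈xz ⟩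
    w * (x * z)    ≈⟨ solve 3 (λ x w y → x :* w :* y := w :* (x :* y)) refl x w z ⟨
    x * w * z      ≈⟨ *-congʳ xw≈1 ⟩
    1# * z         ≈⟨ *-identityˡ z ⟩
    z              ∎

  x*y≈0⇒y≈0 : ∀ {x y} → x # 0# → x * y ≈ 0# → y ≈ 0#
  x*y≈0⇒y≈0 x#0 xy≈0 = *-cancelˡ x#0 (trans xy≈0 (sym (zeroʳ _)))

  x-y≈0⇒x≈y : ∀ {x y} → x - y ≈ 0# → x ≈ y
  x-y≈0⇒x≈y = x∙y⁻¹≈ε⇒x≈y _ _

  ^-#0 : ∀ {x} n → x # 0# → x ^ n # 0#
  ^-#0 zero    x#0 = 1#0
  ^-#0 (suc n) x#0 = x#0y#0→xy#0 x#0 (^-#0 n x#0)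

  ^-#0⁻ : ∀ {x} n .{{_ : ℕ.NonZero n}} → x ^ n # 0# → x # 0#
  ^-#0⁻ (suc n) = x*y#0⇒x#0

  x^n≈0⇒x≈0 : ∀ {x} n → x ^ n ≈ 0# → x ≈ 0#
  x^n≈0⇒x≈0 n xⁿ≈0 = ¬#⇒≈ λ x#0 → #⇒≉ (^-#0 n x#0) xⁿ≈0

  ∏[_-_] : Carrier → List Carrier → Carrier
  ∏[ z - xs ] = List.foldr (λ x u → (z - x) * u) 1# xs

  #-cotrans-All : ∀ {x xs} → All (x #_) xs → ∀ z → x # z ⊎ All (z #_) xs
  #-cotrans-All []           z = inj₂ []
  #-cotrans-All (x#y ∷ x#ys) z with #-cotrans x#y z | #-cotrans-All x#ys z
  ... | inj₁ x#z | _          = inj₁ x#z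
  ... | inj₂ _   | inj₁ x#z   = inj₁ x#z
  ... | inj₂ z#y | inj₂ z#ys  = inj₂ (z#y ∷ z#ys)

  ∏-#0 : ∀ {z xs} → All (z #_) xs → ∏[ z - xs ] # 0#
  ∏-#0 []           = 1#0
  ∏-#0 (z#x ∷ z#xs) = x#0y#0→xy#0 (#⇒-#0 z#x) (∏-#0 z#xs)

  -- Since the roots are pairwise apart, z is apart from all of them but at most one.
  ∏≈0⇒∈ : ∀ {z xs} → AllPairs _#_ xs → ∏[ z - xs ] ≈ 0# → Any (z ≈_) xs
  ∏≈0⇒∈ []                ∏≈0 = contradiction ∏≈0 (#⇒≉ 1#0)
  ∏≈0⇒∈ {z} (x#xs ∷ #xs) ∏≈0 with #-cotrans-All x#xs z
  ... | inj₁ x#z  = there (∏≈0⇒∈ #xs (x*y≈0⇒y≈0 (#⇒-#0 (#-sym x#z)) ∏≈0))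
  ... | inj₂ z#xs = here (x-y≈0⇒x≈y (x*y≈0⇒y≈0 (∏-#0 z#xs) (trans (*-comm _ _) ∏≈0)))

  ∈⇒∏≈0 : ∀ {z xs} → Any (z ≈_) xs → ∏[ z - xs ] ≈ 0#
  ∈⇒∏≈0 {z} {x ∷ xs} (here z≈x) =
    trans (*-congʳ (trans (+-congʳ z≈x) (-‿inverseʳ x))) (zeroˡ _)
  ∈⇒∏≈0 (there z∈xs) = trans (*-congˡ (∈⇒∏≈0 z∈xs)) (zeroʳ _)

  -- monic (a₀ ∷ … ∷ aₘ₋₁ ∷ []) z  =  a₀ + a₁ z + … + aₘ₋₁ zᵐ⁻¹ + zᵐ
  monic : ∀ {m} → Vec Carrier m → Carrier → Carrier
  monic []      z = 1#
  monic (a ∷ p) z = a + z * monic p z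

  -- Synthetic division by X - x: the coefficients are the values at `x` of the successive tails, as
  -- in Horner's scheme.
  quotient : ∀ {m} → Vec Carrier (suc m) → Carrier → Vec Carrier m
  quotient {zero}  _       x = []
  quotient {suc m} (_ ∷ p) x = monic p x ∷ quotient p x

  monic-quotient : ∀ {m} (p : Vec Carrier (suc m)) x z →
                   monic p z - monic p x ≈ (z - x) * monic (quotient p x) z
  monic-quotient {zero}  (a ∷ []) x z =
    solve 3 (λ a x z → a :+ z :* con 1ℤ :- (a :+ x :* con 1ℤ) := (z :- x) :* con 1ℤ) refl a x z
  monic-quotient {suc m} (a ∷ p)  x z = begin
    a + z * monic p z - (a + x * monic p x)
      ≈⟨ solve 5 (λ a x z u v → a :+ z :* u :- (a :+ x :* v) := (z :- x) :* v :+ z :* (u :- v))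
           refl a x z (monic p z) (monic p x) ⟩
    (z - x) * monic p x + z * (monic p z - monic p x)
      ≈⟨ +-congˡ (*-congˡ (monic-quotient p x z)) ⟩
    (z - x) * monic p x + z * ((z - x) * monic (quotient p x) z)
      ≈⟨ solve 4 (λ x z v w → (z :- x) :* v :+ z :* ((z :- x) :* w) := (z :- x) :* (v :+ z :* w))
           refl x z (monic p x) (monic (quotient p x) z) ⟩
    (z - x) * (monic p x + z * monic (quotient p x) z) ∎

  -- Each root is divided out in turn. Apartness from `x` makes `y - x` cancellable, so the other
  -- roots survive in the quotient, and as many roots as the degree leave the quotient 1.
  roots⇒∏ : ∀ {m xs} (p : Vec Carrier m) → length xs ≡ m → AllPairs _#_ xs →
            All (λ x → monic p x ≈ 0#) xs → ∀ z → monic p z ≈ ∏[ z - xs ]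
  roots⇒∏ {xs = []}     [] ≡.refl _            _            z = refl
  roots⇒∏ {xs = x ∷ xs} p  ≡.refl (x#xs ∷ #xs) (px≈0 ∷ p≈0) z = begin
    monic p z                            ≈⟨ factor z ⟩
    (z - x) * monic (quotient p x) z     ≈⟨ *-congˡ (roots⇒∏ (quotient p x) ≡.refl #xs (roots x#xs p≈0) z) ⟩
    (z - x) * ∏[ z - xs ]                ∎
    where
    factor : ∀ y → monic p y ≈ (y - x) * monic (quotient p x) y
    factor y = begin
      monic p y                          ≈⟨ x-0≈x _ ⟨
      monic p y - 0#                     ≈⟨ +-congˡ (-‿cong px≈0) ⟨
      monic p y - monic p x              ≈⟨ monic-quotient p x y ⟩
      (y - x) * monic (quotient p x) y   ∎

    roots : ∀ {ys} → All (x #_) ys → All (λ y → monic p y ≈ 0#) ys →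
            All (λ y → monic (quotient p x) y ≈ 0#) ys
    roots []           []            = []
    roots (x#y ∷ x#ys) (py≈0 ∷ p≈0)  =
      x*y≈0⇒y≈0 (#⇒-#0 (#-sym x#y)) (trans (sym (factor _)) py≈0) ∷ roots x#ys p≈0

  monic-replicate-0 : ∀ m z → monic (Vec.replicate m 0#) z ≈ z ^ m
  monic-replicate-0 zero    z = refl
  monic-replicate-0 (suc m) z = trans (+-identityˡ _) (*-congˡ (monic-replicate-0 m z))

  -- The k given roots split X^k - 1 completely by `roots⇒∏`, so the product of the differences
  -- vanishes at `z` and `∏≈0⇒∈` finds the entry.
  rootOfUnity∈ : ∀ {xs z} k .{{_ : ℕ.NonZero k}} → length xs ≡ k → AllPairs _#_ xs →
                 All (λ x → x ^ k ≈ 1#) xs → z ^ k ≈ 1# → Any (z ≈_) xs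
  rootOfUnity∈ {xs} {z} (suc m) |xs|≡k #xs xs^k≈1 z^k≈1 =
    ∏≈0⇒∈ #xs (trans (sym (roots⇒∏ p |xs|≡k #xs (All.map X^k-1 xs^k≈1) z)) (X^k-1 z^k≈1))
    where
    p : Vec Carrier (suc m)
    p = - 1# ∷ Vec.replicate m 0#
    X^k-1 : ∀ {x} → x ^ suc m ≈ 1# → monic p x ≈ 0#
    X^k-1 {x} x^k≈1 = begin
      - 1# + x * monic (Vec.replicate m 0#) x   ≈⟨ +-congˡ (*-congˡ (monic-replicate-0 m x)) ⟩
      - 1# + x ^ suc m                          ≈⟨ +-congˡ x^k≈1 ⟩
      - 1# + 1#                                 ≈⟨ -‿inverseˡ 1# ⟩
      0#                                        ∎

-- Order, bounds and null sequences of real numbers.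

module RealProperties {c ℓ₁ ℓ₂} (R : RealNumbers c ℓ₁ ℓ₂) where
  open RealNumbers R

  heytingField : HeytingField c ℓ₁ ℓ₂
  heytingField = record { isHeytingField = isHeytingField }

  open HeytingFieldProperties heytingField public hiding (commutativeRing)
  open CommutativeRing commutativeRing public using (ring)
  open RingProperties ring public using (-0#≈0#; -‿involutive)
  open SemiringMult semiring public using (×-homo-+; ×1-homo-*)
  open IntegerCoefficients commutativeRing public

  <-respʳ : ∀ {x y z} → y ≈ z → x < y → x < z
  <-respʳ = proj₁ <-resp-≈

  <-respˡ : ∀ {x y z} → x ≈ y → x < z → y < z
  <-respˡ = proj₂ <-resp-≈

  <-asym : Asymmetric _<_
  <-asym x<y y<x = <-irrefl refl (<-trans x<y y<x)

  <-cotrans : ∀ {x y} → x < y → ∀ z → x < z ⊎ z < y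
  <-cotrans x<y z with #-cotrans (inj₁ x<y) z
  ... | inj₁ (inj₁ x<z) = inj₁ x<z
  ... | inj₁ (inj₂ z<x) = inj₂ (<-trans z<x x<y)
  ... | inj₂ (inj₁ z<y) = inj₂ z<y
  ... | inj₂ (inj₂ y<z) = inj₁ (<-trans x<y y<z)

  -- As `y ≤ z` only denies `z < y`, the positive information has to come from cotransitivity of
  -- `x < y` at `z`.
  <-≤-trans : ∀ {x y z} → x < y → y ≤ z → x < z
  <-≤-trans x<y y≤z with <-cotrans x<y _
  ... | inj₁ x<z = x<z
  ... | inj₂ z<y = contradiction z<y y≤z

  ≤-<-trans : ∀ {x y z} → x ≤ y → y < z → x < z
  ≤-<-trans x≤y y<z with <-cotrans y<z _
  ... | inj₁ y<x = contradiction y<x x≤y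
  ... | inj₂ x<z = x<z

  ≤-trans : ∀ {x y z} → x ≤ y → y ≤ z → x ≤ z
  ≤-trans x≤y y≤z z<x = y≤z (<-≤-trans z<x x≤y)

  ≤-reflexive : ∀ {x y} → x ≈ y → x ≤ y
  ≤-reflexive x≈y = <-irrefl (sym x≈y)

  ≤-isPreorder : IsPreorder _≈_ _≤_
  ≤-isPreorder = record
    { isEquivalence = isEquivalence
    ; reflexive     = ≤-reflexive
    ; trans         = ≤-trans
    }

  open IsPreorder ≤-isPreorder public using () renaming (refl to ≤-refl)

  module ≤-Reasoning =
    TripleReasoning ≤-isPreorder <-asym <-trans <-resp-≈ <-asym <-≤-trans ≤-<-trans

  +-monoʳ-< : ∀ z {x y} → x < y → z + x < z + y
  +-monoʳ-< z x<y = <-respˡ (+-comm _ _) (<-respʳ (+-comm _ _) (+-monoˡ-< z x<y))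

  +-cancelˡ-< : ∀ z {x y} → z + x < z + y → x < y
  +-cancelˡ-< z z+x<z+y = <-respˡ (cancel _) (<-respʳ (cancel _) (+-monoʳ-< (- z) z+x<z+y))
    where
    cancel : ∀ x → - z + (z + x) ≈ x
    cancel x = solve 2 (λ z x → :- z :+ (z :+ x) := x) refl z x

  +-mono-≤ : ∀ {w x y z} → w ≤ x → y ≤ z → w + y ≤ x + z
  +-mono-≤ {w} {x} {y} {z} w≤x y≤z = ≤-trans
    (y≤z ∘ +-cancelˡ-< w)
    (λ x+z<w+z → w≤x (+-cancelˡ-< z (<-respˡ (+-comm _ _) (<-respʳ (+-comm _ _) x+z<w+z))))

  +-mono-<-≤ : ∀ {w x y z} → w < x → y ≤ z → w + y < x + z
  +-mono-<-≤ {w} {x} {y} {z} w<x y≤z =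
    <-≤-trans (+-monoˡ-< y w<x) (+-mono-≤ ≤-refl y≤z)

  x<y⇒0<y-x : ∀ {x y} → x < y → 0# < y - x
  x<y⇒0<y-x {x} x<y = <-respˡ (-‿inverseʳ x) (+-monoˡ-< (- x) x<y)

  0<y-x⇒x<y : ∀ {x y} → 0# < y - x → x < y
  0<y-x⇒x<y {x} {y} 0<y-x = +-cancelˡ-< (- x)
    (<-respˡ (sym (-‿inverseˡ x)) (<-respʳ (+-comm _ _) 0<y-x))

  x≤y⇒0≤y-x : ∀ {x y} → x ≤ y → 0# ≤ y - x
  x≤y⇒0≤y-x {x} {y} x≤y y-x<0 = x≤y (+-cancelˡ-< (- x)
    (<-respˡ (+-comm _ _) (<-respʳ (sym (-‿inverseˡ x)) y-x<0)))

  0≤y-x⇒x≤y : ∀ {x y} → 0# ≤ y - x → x ≤ y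
  0≤y-x⇒x≤y {x} {y} 0≤y-x y<x =
    0≤y-x (<-respʳ (-‿inverseʳ x) (+-monoˡ-< (- x) y<x))

  neg-mono-< : ∀ {x y} → x < y → - y < - x
  neg-mono-< {x} {y} x<y = 0<y-x⇒x<y (<-respʳ
    (solve 2 (λ x y → y :- x := :- x :- :- y) refl x y) (x<y⇒0<y-x x<y))

  neg-mono-≤ : ∀ {x y} → x ≤ y → - y ≤ - x
  neg-mono-≤ x≤y -x<-y = x≤y
    (<-respˡ (-‿involutive _) (<-respʳ (-‿involutive _) (neg-mono-< -x<-y)))

  0<x⇒-x<0 : ∀ {x} → 0# < x → - x < 0#
  0<x⇒-x<0 0<x = <-respʳ -0#≈0# (neg-mono-< 0<x)

  x<0⇒0<-x : ∀ {x} → x < 0# → 0# < - x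
  x<0⇒0<-x x<0 = <-respˡ -0#≈0# (neg-mono-< x<0)

  0<x⇒x#0 : ∀ {x} → 0# < x → x # 0#
  0<x⇒x#0 = inj₂

  *-monoˡ-< : ∀ {x y z} → 0# < x → y < z → x * y < x * z
  *-monoˡ-< {x} {y} {z} 0<x y<z = 0<y-x⇒x<y (<-respʳ
    (solve 3 (λ x y z → x :* (z :- y) := x :* z :- x :* y) refl x y z)
    (*-positive 0<x (x<y⇒0<y-x y<z)))

  -- The product `x * (z - y)` is apart from 0, hence so is `z - y`. Apartness from 0 carries a
  -- sign, and the negative one is refuted by monotonicity.
  *-cancelˡ-< : ∀ {x y z} → 0# < x → x * y < x * z → y < z
  *-cancelˡ-< {x} {y} {z} 0<x xy<xz =
    [ (λ z-y<0 → contradiction (*-monoˡ-< 0<x (z<y z-y<0)) (<-asym xy<xz)) , 0<y-x⇒x<y ]′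
      (x*y#0⇒y#0 x[z-y]#0)
    where
    x[z-y]#0 : x * (z - y) # 0#
    x[z-y]#0 = #-congʳ
      (solve 3 (λ x y z → x :* z :- x :* y := x :* (z :- y)) refl x y z)
      (0<x⇒x#0 (x<y⇒0<y-x xy<xz))

    z<y : z - y < 0# → z < y
    z<y z-y<0 = 0<y-x⇒x<y (<-respʳ (solve 2 (λ y z → :- (z :- y) := y :- z) refl y z) (x<0⇒0<-x z-y<0))

  -- A negative product has both factors apart from 0, so their signs become known and every
  -- combination is absurd.
  *-nonneg : ∀ {x y} → 0# ≤ x → 0# ≤ y → 0# ≤ x * y
  *-nonneg 0≤x 0≤y xy<0 with x*y#0⇒x#0 (inj₁ xy<0) | x*y#0⇒y#0 (inj₁ xy<0)
  ... | inj₁ x<0 | _        = 0≤x x<0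
  ... | inj₂ 0<x | inj₁ y<0 = 0≤y y<0
  ... | inj₂ 0<x | inj₂ 0<y = <-asym xy<0 (*-positive 0<x 0<y)

  +-nonneg : ∀ {x y} → 0# ≤ x → 0# ≤ y → 0# ≤ x + y
  +-nonneg 0≤x 0≤y = ≤-trans (≤-reflexive (sym (+-identityˡ 0#))) (+-mono-≤ 0≤x 0≤y)

  *-monoˡ-≤ : ∀ {x y z} → 0# ≤ x → y ≤ z → x * y ≤ x * z
  *-monoˡ-≤ {x} {y} {z} 0≤x y≤z = 0≤y-x⇒x≤y (≤-trans
    (*-nonneg 0≤x (x≤y⇒0≤y-x y≤z))
    (≤-reflexive (solve 3 (λ x y z → x :* (z :- y) := x :* z :- x :* y) refl x y z)))

  square-positive : ∀ {x} → x # 0# → 0# < x * x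
  square-positive (inj₂ 0<x) = *-positive 0<x 0<x
  square-positive (inj₁ x<0) = <-respʳ (solve 1 (λ x → (:- x) :* (:- x) := x :* x) refl _)
    (*-positive (x<0⇒0<-x x<0) (x<0⇒0<-x x<0))

  square-nonneg : ∀ {x} → 0# ≤ x * x
  square-nonneg x²<0 = <-asym x²<0 (square-positive (x*y#0⇒x#0 (inj₁ x²<0)))

  fromℕ-nonneg : ∀ n → 0# ≤ fromℕ n
  fromℕ-nonneg zero    = ≤-refl
  fromℕ-nonneg (suc n) = <-asym (fromℕ-suc-positive n)

  fromℕ-mono-≤ : ∀ {m n} → m ℕ.≤ n → fromℕ m ≤ fromℕ n
  fromℕ-mono-≤ {n = n} ℕ.z≤n = fromℕ-nonneg n
  fromℕ-mono-≤ (ℕ.s≤s m≤n) = +-mono-≤ (≤-refl {1#}) (fromℕ-mono-≤ m≤n)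

  fromℕ-positive : ∀ n .{{_ : ℕ.NonZero n}} → 0# < fromℕ n
  fromℕ-positive (suc n) = fromℕ-suc-positive n

  fromℕ-mono-< : ∀ {m n} → m ℕ.< n → fromℕ m < fromℕ n
  fromℕ-mono-< {m} {n} m<n = <-≤-trans
    (<-respˡ (+-identityˡ _) (+-monoˡ-< (fromℕ m) 0<1)) (fromℕ-mono-≤ m<n)

  fromℕ*1/ : ∀ n .{{_ : ℕ.NonZero n}} → fromℕ n * 1/ n ≈ 1#
  fromℕ*1/ (suc n) = trans (*-congʳ (sym (x-0≈x _)))
    (proj₂ (proj₂ (#⇒invertible (inj₂ (fromℕ-suc-positive n)))))

  1/-positive : ∀ n .{{_ : ℕ.NonZero n}} → 0# < 1/ n
  1/-positive n = *-cancelˡ-< (fromℕ-positive n)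
    (<-respˡ (sym (zeroʳ _)) (<-respʳ (sym (fromℕ*1/ n)) 0<1))

  1/-unique : ∀ n .{{_ : ℕ.NonZero n}} {x} → fromℕ n * x ≈ 1# → x ≈ 1/ n
  1/-unique n nx≈1 =
    *-cancelˡ (0<x⇒x#0 (fromℕ-positive n)) (trans nx≈1 (sym (fromℕ*1/ n)))

  fromℕ*[x*1/] : ∀ n .{{_ : ℕ.NonZero n}} x → fromℕ n * (x * 1/ n) ≈ x
  fromℕ*[x*1/] n x = trans
    (solve 3 (λ n x r → n :* (x :* r) := x :* (n :* r)) refl _ _ _)
    (trans (*-congˡ (fromℕ*1/ n)) (*-identityʳ x))

  infix 4 ∣_∣≤_
  -- Two inequalities in place of an absolute value, so that no maximum of two reals has to be
  -- constructed.
  ∣_∣≤_ : Carrier → Carrier → Set ℓ₂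
  ∣ x ∣≤ a = x ≤ a × - x ≤ a

  abs-resp : ∀ {x y a} → x ≈ y → ∣ x ∣≤ a → ∣ y ∣≤ a
  abs-resp x≈y (x≤a , -x≤a) =
    ≤-trans (≤-reflexive (sym x≈y)) x≤a , ≤-trans (≤-reflexive (-‿cong (sym x≈y))) -x≤a

  abs-weaken : ∀ {x a b} → a ≤ b → ∣ x ∣≤ a → ∣ x ∣≤ b
  abs-weaken a≤b (x≤a , -x≤a) = ≤-trans x≤a a≤b , ≤-trans -x≤a a≤b

  abs-neg : ∀ {x a} → ∣ x ∣≤ a → ∣ - x ∣≤ a
  abs-neg (x≤a , -x≤a) = -x≤a , ≤-trans (≤-reflexive (-‿involutive _)) x≤a

  abs-0≤ : ∀ {x a} → ∣ x ∣≤ a → 0# ≤ a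
  abs-0≤ (x≤a , -x≤a) a<0 = <-asym x<0
    (<-respʳ (-‿involutive _) (x<0⇒0<-x (≤-<-trans -x≤a a<0)))
    where x<0 = ≤-<-trans x≤a a<0

  opaque
    abs-+ : ∀ {x y a b} → ∣ x ∣≤ a → ∣ y ∣≤ b → ∣ x + y ∣≤ a + b
    abs-+ {x} {y} (x≤a , -x≤a) (y≤b , -y≤b) =
      +-mono-≤ x≤a y≤b ,
      ≤-trans (≤-reflexive (solve 2 (λ x y → :- (x :+ y) := :- x :- y) refl x y)) (+-mono-≤ -x≤a -y≤b)

  -- 2 (a b - x y) = (a - x) (b + y) + (a + x) (b - y)
  opaque
    *-≤-of-abs : ∀ {x y a b} → ∣ x ∣≤ a → ∣ y ∣≤ b → x * y ≤ a * b
    *-≤-of-abs {x} {y} {a} {b} (x≤a , -x≤a) (y≤b , -y≤b) ab<xy =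
      +-mono-≤
        (*-nonneg (x≤y⇒0≤y-x x≤a) (x≤y⇒0≤y-x -y≤b))
        (*-nonneg (x≤y⇒0≤y-x -x≤a) (x≤y⇒0≤y-x y≤b))
        (<-respʳ (sym (+-identityˡ 0#)) (<-respˡ
          (solve 4 (λ x y a b → a :* b :- x :* y :+ (a :* b :- x :* y)
             := (a :- x) :* (b :- :- y) :+ (a :- :- x) :* (b :- y)) refl x y a b)
          (<-respʳ (+-identityʳ 0#) (+-mono-<-≤ ab-xy<0 (<-asym ab-xy<0)))))
      where
      ab-xy<0 : a * b - x * y < 0#
      ab-xy<0 = <-respʳ (-‿inverseʳ _) (+-monoˡ-< (- (x * y)) ab<xy)

  opaque
    abs-* : ∀ {x y a b} → ∣ x ∣≤ a → ∣ y ∣≤ b → ∣ x * y ∣≤ a * b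
    abs-* {x} {y} |x|≤a |y|≤b = *-≤-of-abs |x|≤a |y|≤b ,
      ≤-trans (≤-reflexive (solve 2 (λ x y → :- (x :* y) := (:- x) :* y) refl x y))
        (*-≤-of-abs (abs-neg |x|≤a) |y|≤b)

  abs-nonneg : ∀ {x a} → 0# ≤ x → x ≤ a → ∣ x ∣≤ a
  abs-nonneg 0≤x x≤a = x≤a , ≤-trans (≤-trans (neg-mono-≤ 0≤x) (≤-reflexive -0#≈0#)) (≤-trans 0≤x x≤a)

  opaque
    -- The bound is a successor so that a positive ε can be divided by it, as `Null-scale` does.
    abs-bounded : ∀ x → ∃ λ n → ∣ x ∣≤ fromℕ (suc n)
    abs-bounded x with archimedean x | archimedean (- x)
    ... | m , x<m | n , -x<n = m ℕ.+ n ,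
      (≤-trans (<-asym x<m) (fromℕ-mono-≤ (ℕ.m≤n⇒m≤1+n (ℕ.m≤m+n m n))) ,
       ≤-trans (<-asym -x<n) (fromℕ-mono-≤ (ℕ.m≤n⇒m≤1+n (ℕ.m≤n+m n m))))

  Null : (ℕ → Carrier) → Set (c ⊔ ℓ₂)
  Null s = ∀ ε → 0# < ε → ∃ λ N → ∀ n → N ℕ.≤ n → ∣ s n ∣≤ ε

  ⟶⇒Null : ∀ {s l} → s ⟶ l → Null (λ n → s n - l)
  ⟶⇒Null s⟶l ε 0<ε with s⟶l ε 0<ε
  ... | N , close = N , λ n N≤n →
    <-asym (proj₁ (close n N≤n)) ,
    ≤-trans (≤-reflexive (solve 2 (λ x y → :- (x :- y) := y :- x) refl _ _))
      (<-asym (proj₂ (close n N≤n)))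

  Null-dominated : ∀ {s t} → (∀ n → ∣ s n ∣≤ t n) → Null t → Null s
  Null-dominated |s|≤t null-t ε 0<ε with null-t ε 0<ε
  ... | N , small = N , λ n N≤n → abs-weaken (proj₁ (small n N≤n)) (|s|≤t n)

  Null-cong : ∀ {s t} → (∀ n → s n ≈ t n) → Null s → Null t
  Null-cong s≈t null-s ε 0<ε with null-s ε 0<ε
  ... | N , small = N , λ n N≤n → abs-resp (s≈t n) (small n N≤n)

  Null-subsequence : ∀ {s} (f : ℕ → ℕ) → (∀ n → n ℕ.≤ f n) → Null s → Null (s ∘ f)
  Null-subsequence f n≤f null-s ε 0<ε with null-s ε 0<ε
  ... | N , small = N , λ n N≤n → small (f n) (ℕ.≤-trans N≤n (n≤f n))

  Null-neg : ∀ {s} → Null s → Null (λ n → - s n)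
  Null-neg null-s ε 0<ε with null-s ε 0<ε
  ... | N , small = N , λ n N≤n → abs-neg (small n N≤n)

  opaque
    fraction : ∀ {x} n → 0# < x → ∃ λ y → 0# < y × fromℕ (suc n) * y ≈ x
    fraction {x} n 0<x =
      x * 1/ suc n , *-positive 0<x (1/-positive (suc n)) , fromℕ*[x*1/] (suc n) x

  opaque
    half : ∀ {x} → 0# < x → ∃ λ y → 0# < y × y + y ≈ x
    half 0<x with fraction 1 0<x
    ... | y , 0<y , 2y≈x = y , 0<y ,
      trans (solve 1 (λ y → y :+ y := (con 1ℤ :+ (con 1ℤ :+ con 0ℤ)) :* y) refl y) 2y≈x

  Null-+ : ∀ {s t} → Null s → Null t → Null (λ n → s n + t n)
  Null-+ null-s null-t ε 0<ε with half 0<ε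
  ... | δ , 0<δ , δ+δ≈ε with null-s δ 0<δ | null-t δ 0<δ
  ... | M , small-s | N , small-t = M ℕ.+ N , λ n M+N≤n →
    abs-weaken (≤-reflexive δ+δ≈ε) (abs-+
      (small-s n (ℕ.≤-trans (ℕ.m≤m+n M N) M+N≤n))
      (small-t n (ℕ.≤-trans (ℕ.m≤n+m N M) M+N≤n)))

  Null-scale : ∀ x {s} → Null s → Null (λ n → x * s n)
  Null-scale x null-s ε 0<ε with abs-bounded x
  ... | b , |x|≤1+b with fraction b 0<ε
  ... | δ , 0<δ , bδ≈ε with null-s δ 0<δ
  ... | N , small = N , λ n N≤n →
    abs-weaken (≤-reflexive bδ≈ε) (abs-* |x|≤1+b (small n N≤n))

  Null-* : ∀ {s t} → Null s → Null t → Null (λ n → s n * t n)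
  Null-* null-s null-t ε 0<ε with null-s 1# 0<1 | null-t ε 0<ε
  ... | M , small-s | N , small-t = M ℕ.+ N , λ n M+N≤n →
    abs-weaken (≤-reflexive (*-identityˡ ε)) (abs-*
      (small-s n (ℕ.≤-trans (ℕ.m≤m+n M N) M+N≤n))
      (small-t n (ℕ.≤-trans (ℕ.m≤n+m N M) M+N≤n)))

  -- Uniqueness of limits in the form used below: an identity between limits follows once their
  -- constant difference is written as a null sequence.
  Null-const : ∀ {x} → Null (λ _ → x) → x ≈ 0#
  Null-const {x} null = ¬#⇒≈
    [ (λ x<0 → ¬positive (Null-neg null) (x<0⇒0<-x x<0)) , ¬positive null ]′
    where
    ¬positive : ∀ {y} → Null (λ _ → y) → ¬ (0# < y)
    ¬positive {y} null 0<y with half 0<y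
    ... | δ , 0<δ , δ+δ≈y with null δ 0<δ
    ... | N , small = proj₁ (small N ℕ.≤-refl) (<-respʳ δ+δ≈y
      (<-respˡ (+-identityʳ δ) (+-monoʳ-< δ 0<δ)))

-- The Heyting field of complex numbers.

module ComplexField {c ℓ₁ ℓ₂} (R : RealNumbers c ℓ₁ ℓ₂) where
  open ComplexNumbers R
  private
    module ℝ where
      open RealNumbers R public
      open RealProperties R public
    open ℝ using (solve; _:=_; _:+_; _:*_; _:-_; :-_; con)

  opaque
    *-cong : ∀ {x x′ y y′} → x ≈ x′ → y ≈ y′ → x * y ≈ x′ * y′
    *-cong (p , q) (r , s) =
      ℝ.+-cong (ℝ.*-cong p r) (ℝ.-‿cong (ℝ.*-cong q s)) ,
      ℝ.+-cong (ℝ.*-cong p s) (ℝ.*-cong q r)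

    *-comm : ∀ x y → x * y ≈ y * x
    *-comm (a , b) (a′ , b′) =
      solve 4 (λ a b a′ b′ → a :* a′ :- b :* b′ := a′ :* a :- b′ :* b) ℝ.refl a b a′ b′ ,
      solve 4 (λ a b a′ b′ → a :* b′ :+ b :* a′ := a′ :* b :+ b′ :* a) ℝ.refl a b a′ b′

    *-assoc : ∀ x y z → x * y * z ≈ x * (y * z)
    *-assoc (a , b) (a′ , b′) (a″ , b″) =
      solve 6 (λ a b a′ b′ a″ b″ →
        (a :* a′ :- b :* b′) :* a″ :- (a :* b′ :+ b :* a′) :* b″
          := a :* (a′ :* a″ :- b′ :* b″) :- b :* (a′ :* b″ :+ b′ :* a″))
        ℝ.refl a b a′ b′ a″ b″ ,
      solve 6 (λ a b a′ b′ a″ b″ →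
        (a :* a′ :- b :* b′) :* b″ :+ (a :* b′ :+ b :* a′) :* a″
          := a :* (a′ :* b″ :+ b′ :* a″) :+ b :* (a′ :* a″ :- b′ :* b″))
        ℝ.refl a b a′ b′ a″ b″

    *-identityˡ : ∀ x → 1ℂ * x ≈ x
    *-identityˡ (a , b) =
      solve 2 (λ a b → con 1ℤ :* a :- con 0ℤ :* b := a) ℝ.refl a b ,
      solve 2 (λ a b → con 1ℤ :* b :+ con 0ℤ :* a := b) ℝ.refl a b

    *-identityʳ : ∀ x → x * 1ℂ ≈ x
    *-identityʳ (a , b) =
      solve 2 (λ a b → a :* con 1ℤ :- b :* con 0ℤ := a) ℝ.refl a b ,
      solve 2 (λ a b → a :* con 0ℤ :+ b :* con 1ℤ := b) ℝ.refl a b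

    distribˡ : ∀ x y z → x * (y + z) ≈ x * y + x * z
    distribˡ (a , b) (a′ , b′) (a″ , b″) =
      solve 6 (λ a b a′ b′ a″ b″ → a :* (a′ :+ a″) :- b :* (b′ :+ b″)
        := a :* a′ :- b :* b′ :+ (a :* a″ :- b :* b″)) ℝ.refl a b a′ b′ a″ b″ ,
      solve 6 (λ a b a′ b′ a″ b″ → a :* (b′ :+ b″) :+ b :* (a′ :+ a″)
        := a :* b′ :+ b :* a′ :+ (a :* b″ :+ b :* a″)) ℝ.refl a b a′ b′ a″ b″

    distribʳ : ∀ z x y → (x + y) * z ≈ x * z + y * z
    distribʳ (a″ , b″) (a , b) (a′ , b′) =
      solve 6 (λ a b a′ b′ a″ b″ → (a :+ a′) :* a″ :- (b :+ b′) :* b″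
        := a :* a″ :- b :* b″ :+ (a′ :* a″ :- b′ :* b″)) ℝ.refl a b a′ b′ a″ b″ ,
      solve 6 (λ a b a′ b′ a″ b″ → (a :+ a′) :* b″ :+ (b :+ b′) :* a″
        := a :* b″ :+ b :* a″ :+ (a′ :* b″ :+ b′ :* a″)) ℝ.refl a b a′ b′ a″ b″

  commutativeRing : CommutativeRing c ℓ₁
  commutativeRing = record
    { isCommutativeRing = record
      { isRing = record
        { +-isAbelianGroup = DirectProduct+.isAbelianGroup
        ; *-cong           = *-cong
        ; *-assoc          = *-assoc
        ; *-identity       = *-identityˡ , *-identityʳ
        ; distrib          = distribˡ , distribʳ
        }
      ; *-comm = *-comm
      }
    }
    where
    module DirectProduct+ = AbelianGroup (DirectProduct.abelianGroup
      (CommutativeRing.+-abelianGroup ℝ.commutativeRing)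
      (CommutativeRing.+-abelianGroup ℝ.commutativeRing))

  open CommutativeRing commutativeRing using (_-_; trans)

  infix 4 _#_
  _#_ : ℂ → ℂ → Set ℓ₂
  x # y = re x ℝ.# re y ⊎ im x ℝ.# im y

  ∣_∣² : ℂ → ℝ.Carrier
  ∣ z ∣² = re z ℝ.* re z ℝ.+ im z ℝ.* im z

  #0⇒0<∣∣² : ∀ {z} → z # 0ℂ → ℝ.0# ℝ.< ∣ z ∣²
  #0⇒0<∣∣² {z} (inj₁ re#0) = ℝ.<-respˡ (ℝ.+-identityˡ _)
    (ℝ.+-mono-<-≤ (ℝ.square-positive re#0) (ℝ.square-nonneg {im z}))
  #0⇒0<∣∣² {z} (inj₂ im#0) = ℝ.<-respˡ (ℝ.+-identityˡ _) (ℝ.<-respʳ (ℝ.+-comm _ _)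
    (ℝ.+-mono-<-≤ (ℝ.square-positive im#0) (ℝ.square-nonneg {re z})))

  opaque
    *-inverse : ∀ z r → ∣ z ∣² ℝ.* r ℝ.≈ ℝ.1# → z * (re z ℝ.* r , ℝ.- im z ℝ.* r) ≈ 1ℂ
    *-inverse (a , b) r ∣z∣²r≈1 =
      ℝ.trans (solve 3 (λ a b r → a :* (a :* r) :- b :* ((:- b) :* r) := (a :* a :+ b :* b) :* r)
                 ℝ.refl a b r) ∣z∣²r≈1 ,
      solve 3 (λ a b r → a :* ((:- b) :* r) :+ b :* (a :* r) := con 0ℤ) ℝ.refl a b r

    #0⇒inverse : ∀ {z} → z # 0ℂ → ∃ λ w → z * w ≈ 1ℂ
    #0⇒inverse {z} z#0 =
      _ , *-inverse z _ (proj₂ (ℝ.inverse (ℝ.0<x⇒x#0 (#0⇒0<∣∣² {z} z#0))))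

    -- The real part of `z * w` is a difference of two real products and equals 1. One of these
    -- products is therefore apart from 0, and with it a coordinate of `z`.
    inverse⇒#0 : ∀ {z w} → z * w ≈ 1ℂ → z # 0ℂ
    inverse⇒#0 {a , b} {a′ , b′} (re≈1 , _)
      with ℝ.x+y#0⇒x#0⊎y#0 (ℝ.#-congʳ (ℝ.sym re≈1) ℝ.1#0)
    ... | inj₁ aa′#0  = inj₁ (ℝ.x*y#0⇒x#0 aa′#0)
    ... | inj₂ -bb′#0 = inj₂ (ℝ.x*y#0⇒x#0 {b} {b′} (ℝ.#-congʳ (ℝ.-‿involutive _) (ℝ.-#0 -bb′#0)))

    #⇒-#0 : ∀ {x y} → x # y → x - y # 0ℂ
    #⇒-#0 (inj₁ re#) = inj₁ (ℝ.#⇒-#0 re#)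
    #⇒-#0 (inj₂ im#) = inj₂ (ℝ.#⇒-#0 im#)

    -#0⇒# : ∀ {x y} → x - y # 0ℂ → x # y
    -#0⇒# (inj₁ re#) = inj₁ (ℝ.-#0⇒# re#)
    -#0⇒# (inj₂ im#) = inj₂ (ℝ.-#0⇒# im#)

    #-cotrans : ∀ {x y} → x # y → ∀ z → x # z ⊎ z # y
    #-cotrans (inj₁ re#) z = [ inj₁ ∘ inj₁ , inj₂ ∘ inj₁ ]′ (ℝ.#-cotrans re# (re z))
    #-cotrans (inj₂ im#) z = [ inj₁ ∘ inj₂ , inj₂ ∘ inj₂ ]′ (ℝ.#-cotrans im# (im z))

  heytingField : HeytingField c ℓ₁ ℓ₂
  heytingField = record
    { _#_ = _#_
    ; isHeytingField = record
      { isHeytingCommutativeRing = record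
        { isCommutativeRing   = CommutativeRing.isCommutativeRing commutativeRing
        ; isApartnessRelation = record
          { irrefl  = λ (re≈ , im≈) → [ ℝ.#-irrefl re≈ , ℝ.#-irrefl im≈ ]′
          ; sym     = [ inj₁ ∘ swap , inj₂ ∘ swap ]′
          ; cotrans = #-cotrans
          }
        ; #⇒invertible = λ x#y → let w , zw≈1 = #0⇒inverse (#⇒-#0 x#y) in
                           w , trans (*-comm _ _) zw≈1 , zw≈1
        ; invertible⇒# = λ (w , _ , zw≈1) → -#0⇒# (inverse⇒#0 zw≈1)
        }
      ; tight = λ x y →
          (λ ¬x#y → ℝ.¬#⇒≈ (¬x#y ∘ inj₁) , ℝ.¬#⇒≈ (¬x#y ∘ inj₂)) ,
          (λ (re≈ , im≈) → [ ℝ.#-irrefl re≈ , ℝ.#-irrefl im≈ ]′)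
      }
    }

-- A norm on ℂ and the error of the Cauchy product.

module ComplexNorm {c ℓ₁ ℓ₂} (R : RealNumbers c ℓ₁ ℓ₂) where
  open ComplexNumbers R
  open ComplexField R using (commutativeRing)
  private
    module ℂ = CommutativeRing commutativeRing
    module ℝ where
      open RealNumbers R public
      open RealProperties R public
      open Convolution (RealNumbers.commutativeRing R) public
  open ℝ using (∣_∣≤_; solve; _:=_; _:+_; _:*_)
  open ℂ using (_-_)
  open Convolution commutativeRing

  -- A bound on the norm |re z| + |im z|, which is submultiplicative and, unlike the modulus,
  -- needs no square roots.
  infix 4 ‖_‖≤_
  record ‖_‖≤_ (z : ℂ) (r : ℝ.Carrier) : Set (c ⊔ ℓ₂) where
    constructor norm
    field
      {a b}  : ℝ.Carrier
      |re|≤a : ∣ re z ∣≤ a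
      |im|≤b : ∣ im z ∣≤ b
      a+b≤r  : a ℝ.+ b ℝ.≤ r

  opaque
    ‖‖-weaken : ∀ {z r s} → r ℝ.≤ s → ‖ z ‖≤ r → ‖ z ‖≤ s
    ‖‖-weaken r≤s (norm |re|≤a |im|≤b a+b≤r) = norm |re|≤a |im|≤b (ℝ.≤-trans a+b≤r r≤s)

    ‖‖-cong : ∀ {y z r} → y ≈ z → ‖ y ‖≤ r → ‖ z ‖≤ r
    ‖‖-cong (re≈ , im≈) (norm |re|≤a |im|≤b a+b≤r) =
      norm (ℝ.abs-resp re≈ |re|≤a) (ℝ.abs-resp im≈ |im|≤b) a+b≤r

    ‖ofReal‖ : ∀ {x} → ℝ.0# ℝ.≤ x → ‖ ofReal x ‖≤ x
    ‖ofReal‖ {x} 0≤x = norm (ℝ.abs-nonneg 0≤x (ℝ.≤-refl {x}))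
      (ℝ.abs-nonneg (ℝ.≤-refl {ℝ.0#}) (ℝ.≤-refl {ℝ.0#})) (ℝ.≤-reflexive (ℝ.+-identityʳ x))

    ‖‖-+ : ∀ {y z r s} → ‖ y ‖≤ r → ‖ z ‖≤ s → ‖ y + z ‖≤ r ℝ.+ s
    ‖‖-+ (norm {a} {b} re₁ im₁ a+b≤r) (norm {a′} {b′} re₂ im₂ a′+b′≤s) =
      norm (ℝ.abs-+ re₁ re₂) (ℝ.abs-+ im₁ im₂) (ℝ.≤-trans (ℝ.≤-reflexive
        (solve 4 (λ a b a′ b′ → a :+ a′ :+ (b :+ b′) := a :+ b :+ (a′ :+ b′)) ℝ.refl a b a′ b′))
        (ℝ.+-mono-≤ a+b≤r a′+b′≤s))

    ‖‖-* : ∀ {y z r s} → ‖ y ‖≤ r → ‖ z ‖≤ s → ‖ y * z ‖≤ r ℝ.* s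
    ‖‖-* {r = r} {s} (norm {a} {b} re₁ im₁ a+b≤r) (norm {a′} {b′} re₂ im₂ a′+b′≤s) =
      norm (ℝ.abs-+ (ℝ.abs-* re₁ re₂) (ℝ.abs-neg (ℝ.abs-* im₁ im₂)))
           (ℝ.abs-+ (ℝ.abs-* re₁ im₂) (ℝ.abs-* im₁ re₂))
           (begin
             a ℝ.* a′ ℝ.+ b ℝ.* b′ ℝ.+ (a ℝ.* b′ ℝ.+ b ℝ.* a′)
               ≈⟨ solve 4 (λ a b a′ b′ → a :* a′ :+ b :* b′ :+ (a :* b′ :+ b :* a′)
                             := (a :+ b) :* (a′ :+ b′)) ℝ.refl a b a′ b′ ⟩
             (a ℝ.+ b) ℝ.* (a′ ℝ.+ b′)
               ≤⟨ ℝ.*-monoˡ-≤ 0≤a+b a′+b′≤s ⟩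
             (a ℝ.+ b) ℝ.* s
               ≈⟨ ℝ.*-comm _ _ ⟩
             s ℝ.* (a ℝ.+ b)
               ≤⟨ ℝ.*-monoˡ-≤ 0≤s a+b≤r ⟩
             s ℝ.* r
               ≈⟨ ℝ.*-comm _ _ ⟩
             r ℝ.* s ∎)
      where
      open ℝ.≤-Reasoning
      0≤a+b : ℝ.0# ℝ.≤ a ℝ.+ b
      0≤a+b = ℝ.+-nonneg (ℝ.abs-0≤ re₁) (ℝ.abs-0≤ im₁)
      0≤s : ℝ.0# ℝ.≤ s
      0≤s = ℝ.≤-trans (ℝ.+-nonneg (ℝ.abs-0≤ re₂) (ℝ.abs-0≤ im₂)) a′+b′≤s

    ‖‖⇒re : ∀ {z r} → ‖ z ‖≤ r → ∣ re z ∣≤ r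
    ‖‖⇒re (norm {a} {b} |re|≤a |im|≤b a+b≤r) = ℝ.abs-weaken
      (ℝ.≤-trans (ℝ.≤-reflexive (ℝ.sym (ℝ.+-identityʳ a)))
        (ℝ.≤-trans (ℝ.+-mono-≤ (ℝ.≤-refl {a}) (ℝ.abs-0≤ |im|≤b)) a+b≤r)) |re|≤a

    ‖‖⇒im : ∀ {z r} → ‖ z ‖≤ r → ∣ im z ∣≤ r
    ‖‖⇒im (norm {a} {b} |re|≤a |im|≤b a+b≤r) = ℝ.abs-weaken
      (ℝ.≤-trans (ℝ.≤-reflexive (ℝ.sym (ℝ.+-identityˡ b)))
        (ℝ.≤-trans (ℝ.+-mono-≤ (ℝ.abs-0≤ |re|≤a) (ℝ.≤-refl {b})) a+b≤r)) |im|≤b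

    ‖‖-bounded : ∀ z → ∃ λ r → ℝ.0# ℝ.≤ r × ‖ z ‖≤ r
    ‖‖-bounded (x , y) with ℝ.abs-bounded x | ℝ.abs-bounded y
    ... | m , |x|≤m | n , |y|≤n =
      ℝ.fromℕ (suc m ℕ.+ suc n) , ℝ.fromℕ-nonneg (suc m ℕ.+ suc n) ,
      norm |x|≤m |y|≤n (ℝ.≤-reflexive (ℝ.sym (ℝ.×-homo-+ ℝ.1# (suc m) (suc n))))

    ‖^‖ : ∀ {z r} → ℝ.0# ℝ.≤ r → ‖ z ‖≤ r → ∀ n → ‖ z ^ n ‖≤ r ℝ.^ n
    ‖^‖ 0≤r ‖z‖≤r zero    = ‖ofReal‖ (ℝ.<-asym ℝ.0<1)
    ‖^‖ 0≤r ‖z‖≤r (suc n) = ‖‖-* ‖z‖≤r (‖^‖ 0≤r ‖z‖≤r n)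

  opaque
    Σ<-bound : ∀ {g G} → (∀ i → ‖ g i ‖≤ G i) → ∀ n → ‖ Σ< g n ‖≤ ℝ.Σ< G n
    Σ<-bound ‖g‖≤G zero    = ‖ofReal‖ (ℝ.≤-refl {ℝ.0#})
    Σ<-bound ‖g‖≤G (suc n) = ‖‖-+ (‖g‖≤G 0) (Σ<-bound (‖g‖≤G ∘ suc) n)

    Σ<-tail-bound : ∀ {g G} → (∀ i → ‖ g i ‖≤ G i) → ∀ {m n} → m ℕ.≤ n →
                    ‖ Σ< g n - Σ< g m ‖≤ ℝ.Σ< G n ℝ.- ℝ.Σ< G m
    Σ<-tail-bound ‖g‖≤G {n = n} ℕ.z≤n =
      ‖‖-weaken (ℝ.≤-reflexive (ℝ.sym (ℝ.x-0≈x _)))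
        (‖‖-cong (ℂ.sym (ℂ.trans (ℂ.+-congˡ ℂ-0≈0) (ℂ.+-identityʳ _))) (Σ<-bound ‖g‖≤G n))
      where
      ℂ-0≈0 : - 0ℂ ≈ 0ℂ
      ℂ-0≈0 = ℝ.-0#≈0# , ℝ.-0#≈0#
    Σ<-tail-bound {g} {G} ‖g‖≤G {suc m} {suc n} (ℕ.s≤s m≤n) =
      ‖‖-weaken (ℝ.≤-reflexive (ℝ.sym (ℝ.Σ<-suc-- G m n)))
        (‖‖-cong (ℂ.sym (Σ<-suc-- g m n)) (Σ<-tail-bound (‖g‖≤G ∘ suc) m≤n))

    -- The left side is the sum of `f i * g j` over i < m, j < n, m ≤ i + j, and the bound is the
    -- same sum for the majorants. Removing the head of `f` lowers `m` but not `n`, so the induction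
    -- needs two separate lengths.
    Σ<*Σ<-tri-bound : ∀ {f F g G} → (∀ i → ‖ f i ‖≤ F i) → (∀ i → ‖ g i ‖≤ G i) →
      ∀ {m n} → m ℕ.≤ n →
      ‖ Σ< f m * Σ< g n - tri f g m ‖≤ ℝ.Σ< F m ℝ.* ℝ.Σ< G n ℝ.- ℝ.tri F G m
    Σ<*Σ<-tri-bound {g = g} {G} ‖f‖≤F ‖g‖≤G {zero} {n} m≤n =
      ‖‖-weaken (ℝ.≤-reflexive (ℝ.sym (ℝ.0*x-0≈0 (ℝ.Σ< G n))))
        (‖‖-cong (ℂ.sym (0*x-0≈0 (Σ< g n))) (‖ofReal‖ (ℝ.≤-refl {ℝ.0#})))
    Σ<*Σ<-tri-bound {f} {F} {g} {G} ‖f‖≤F ‖g‖≤G {suc m} {n} m≤n =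
      ‖‖-weaken (ℝ.≤-reflexive (ℝ.sym (ℝ.Σ<*Σ<-tri-suc F G m n)))
        (‖‖-cong (ℂ.sym (Σ<*Σ<-tri-suc f g m n))
          (‖‖-+ (‖‖-* (‖f‖≤F 0) (Σ<-tail-bound ‖g‖≤G m≤n))
                (Σ<*Σ<-tri-bound (‖f‖≤F ∘ suc) ‖g‖≤G (ℕ.<⇒≤ m≤n))))

    Σ<-nonneg : ∀ {F} → (∀ i → ℝ.0# ℝ.≤ F i) → ∀ n → ℝ.0# ℝ.≤ ℝ.Σ< F n
    Σ<-nonneg 0≤F zero    = ℝ.≤-refl {ℝ.0#}
    Σ<-nonneg 0≤F (suc n) = ℝ.+-nonneg (0≤F 0) (Σ<-nonneg (0≤F ∘ suc) n)

    Σ<-mono : ∀ {F} → (∀ i → ℝ.0# ℝ.≤ F i) → ∀ {m n} → m ℕ.≤ n → ℝ.Σ< F m ℝ.≤ ℝ.Σ< F n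
    Σ<-mono 0≤F {n = n} ℕ.z≤n   = Σ<-nonneg 0≤F n
    Σ<-mono {F} 0≤F (ℕ.s≤s m≤n) = ℝ.+-mono-≤ (ℝ.≤-refl {F 0}) (Σ<-mono (0≤F ∘ suc) m≤n)

    tri-nonneg : ∀ {F G} → (∀ i → ℝ.0# ℝ.≤ F i) → (∀ i → ℝ.0# ℝ.≤ G i) →
                 ∀ n → ℝ.0# ℝ.≤ ℝ.tri F G n
    tri-nonneg 0≤F 0≤G zero    = ℝ.≤-refl {ℝ.0#}
    tri-nonneg 0≤F 0≤G (suc n) =
      ℝ.+-nonneg (ℝ.*-nonneg (0≤F 0) (Σ<-nonneg 0≤G (suc n))) (tri-nonneg (0≤F ∘ suc) 0≤G n)

    -- The terms are nonnegative, and the rectangle i < m, j < n lies in the triangle i + j < m + n.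
    -- For m = n this turns the error bound into a difference of two triangles, which for
    -- exponential series are partial sums.
    Σ<*Σ<≤tri : ∀ {F G} → (∀ i → ℝ.0# ℝ.≤ F i) → (∀ i → ℝ.0# ℝ.≤ G i) →
                ∀ m n → ℝ.Σ< F m ℝ.* ℝ.Σ< G n ℝ.≤ ℝ.tri F G (m ℕ.+ n)
    Σ<*Σ<≤tri 0≤F 0≤G zero    n =
      ℝ.≤-trans (ℝ.≤-reflexive (ℝ.zeroˡ _)) (tri-nonneg 0≤F 0≤G n)
    Σ<*Σ<≤tri 0≤F 0≤G (suc m) n = ℝ.≤-trans (ℝ.≤-reflexive (ℝ.distribʳ _ _ _))
      (ℝ.+-mono-≤
        (ℝ.*-monoˡ-≤ (0≤F 0) (Σ<-mono 0≤G (ℕ.m≤n⇒m≤1+n (ℕ.m≤n+m n m))))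
        (Σ<*Σ<≤tri (0≤F ∘ suc) 0≤G m n))

    Σ<*Σ<-tri-bound-double : ∀ {f F g G} →
      (∀ i → ‖ f i ‖≤ F i) → (∀ i → ‖ g i ‖≤ G i) →
      (∀ i → ℝ.0# ℝ.≤ F i) → (∀ i → ℝ.0# ℝ.≤ G i) →
      ∀ n → ‖ Σ< f n * Σ< g n - tri f g n ‖≤ ℝ.tri F G (n ℕ.+ n) ℝ.- ℝ.tri F G n
    Σ<*Σ<-tri-bound-double {F = F} {G = G} ‖f‖≤F ‖g‖≤G 0≤F 0≤G n =
      ‖‖-weaken (ℝ.+-mono-≤ (Σ<*Σ<≤tri 0≤F 0≤G n n) (ℝ.≤-refl {ℝ.- ℝ.tri F G n}))
        (Σ<*Σ<-tri-bound ‖f‖≤F ‖g‖≤G {n} {n} ℕ.≤-refl)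

-- Ring identities for error terms and Horner evaluation.

module Identities {c ℓ} (R : CommutativeRing c ℓ) where
  open CommutativeRing R
  open IntegerCoefficients R

  -- Capital letters stand for partial sums, small ones for their limits. Every summand on the left
  -- tends to 0 for the exponential, so the constant on the right is 0.
  product-error : ∀ X Y Z x y z →
    X * Y - Z + (- (y * (X - x)) + (- (x * (Y - y)) + (- ((X - x) * (Y - y)) + (Z - z))))
      ≈ x * y - z
  product-error = solve 6 (λ X Y Z x y z →
    X :* Y :- Z :+ (:- (y :* (X :- x)) :+ (:- (x :* (Y :- y)) :+ (:- ((X :- x) :* (Y :- y)) :+ (Z :- z))))
      := x :* y :- z) refl

  difference-error : ∀ X x y → X - y + - (X - x) ≈ x - y
  difference-error = solve 3 (λ X x y → X :- y :+ :- (X :- x) := x :- y) refl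

  factor-difference : ∀ x y → x * (y - 1#) ≈ x * y - x
  factor-difference = solve 2 (λ x y → x :* (y :- con 1ℤ) := x :* y :- x) refl

  horner-+ : ∀ a b z p q → (a + b) + z * (p + q) ≈ (a + z * p) + (b + z * q)
  horner-+ = solve 5 (λ a b z p q → (a :+ b) :+ z :* (p :+ q) := (a :+ z :* p) :+ (b :+ z :* q)) refl

  horner-scale : ∀ a b z q → a * b + z * (a * q) ≈ a * (b + z * q)
  horner-scale = solve 4 (λ a b z q → a :* b :+ z :* (a :* q) := a :* (b :+ z :* q)) refl

  horner-* : ∀ a z p q → a * q + (0# + z * (p * q)) ≈ (a + z * p) * q
  horner-* = solve 4 (λ a z p q → a :* q :+ (con 0ℤ :+ z :* (p :* q)) := (a :+ z :* p) :* q) refl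

  horner-linear : ∀ a z → - a + z * (1# + z * 0#) ≈ z - a
  horner-linear = solve 2 (λ a z → :- a :+ z :* (con 1ℤ :+ z :* con 0ℤ) := z :- a) refl

-- The functional equation of the exponential function.

module ComplexExponential {c ℓ₁ ℓ₂} (R : RealNumbers c ℓ₁ ℓ₂)
  (exp : ComplexNumbers.ℂ R → ComplexNumbers.ℂ R) (isExp : ComplexNumbers.IsExp R exp) where
  open ComplexNumbers R
  open ComplexNorm R
  open ComplexField R using (commutativeRing)
  private
    module ℂ where
      open CommutativeRing commutativeRing public
      open SemiringMult semiring public using () renaming (_×_ to _·_)
    module ℝ where
      open RealNumbers R public
      open RealProperties R public
  open ℝ using (solve; _:=_; _:+_; _:*_; _:-_; :-_; con)
  open ℂ using (_-_)
  open Convolution commutativeRing using (Σ<; Σ<-cong; tri)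
  open HeytingFieldProperties (ComplexField.heytingField R) using (x-y≈0⇒x≈y)
  open Exp ℂ.semiring using (^-congˡ)

  1/_! : ℕ → ℝ.Carrier
  1/ n ! = ℝ.1/ (n !)

  opaque
    1/0!≈1 : 1/ 0 ! ℝ.≈ ℝ.1#
    1/0!≈1 = ℝ.sym (ℝ.1/-unique 1 (ℝ.trans (ℝ.*-identityʳ _) (ℝ.+-identityʳ _)))

    1/[1+n]! : ∀ n → ℝ.fromℕ (suc n) ℝ.* 1/ suc n ! ℝ.≈ 1/ n !
    1/[1+n]! n = ℝ.1/-unique (n !) {{n ℕ.!≢0}} (begin
      ℝ.fromℕ (n !) ℝ.* (ℝ.fromℕ (suc n) ℝ.* 1/ suc n !)
        ≈⟨ ℝ.*-assoc _ _ _ ⟨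
      ℝ.fromℕ (n !) ℝ.* ℝ.fromℕ (suc n) ℝ.* 1/ suc n !
        ≈⟨ ℝ.*-congʳ (ℝ.trans (ℝ.*-comm _ _) (ℝ.sym (ℝ.×1-homo-* (suc n) (n !)))) ⟩
      ℝ.fromℕ (suc n !) ℝ.* 1/ suc n !
        ≈⟨ ℝ.fromℕ*1/ (suc n !) {{suc n ℕ.!≢0}} ⟩
      ℝ.1# ∎)
      where open SetoidReasoning ℝ.setoid

    ofReal-* : ∀ x y → ofReal x * ofReal y ≈ ofReal (x ℝ.* y)
    ofReal-* x y =
      solve 2 (λ x y → x :* y :- con 0ℤ :* con 0ℤ := x :* y) ℝ.refl x y ,
      solve 2 (λ x y → x :* con 0ℤ :+ con 0ℤ :* y := con 0ℤ) ℝ.refl x y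

    ofReal-^ : ∀ x n → ofReal x ^ n ≈ ofReal (x ℝ.^ n)
    ofReal-^ x zero    = ℂ.refl
    ofReal-^ x (suc n) = ℂ.trans (ℂ.*-congˡ (ofReal-^ x n)) (ofReal-* x _)

    ·1ℂ : ∀ n → n ℂ.· 1ℂ ≈ ofReal (ℝ.fromℕ n)
    ·1ℂ zero    = ℂ.refl
    ·1ℂ (suc n) = ℂ.trans (ℂ.+-congˡ (·1ℂ n)) (ℝ.refl , ℝ.+-identityʳ _)

    1/[1+n]!ℂ : ∀ n → suc n ℂ.· 1ℂ * ofReal (1/ suc n !) ≈ ofReal (1/ n !)
    1/[1+n]!ℂ n = ℂ.trans (ℂ.*-congʳ (·1ℂ (suc n)))
      (ℂ.trans (ofReal-* _ _) (1/[1+n]! n , ℝ.refl))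

    ·-cancelˡ : ∀ n {x y} → ℝ.fromℕ (suc n) ℝ.* x ℝ.≈ ℝ.fromℕ (suc n) ℝ.* y → x ℝ.≈ y
    ·-cancelˡ n = ℝ.*-cancelˡ (ℝ.0<x⇒x#0 (ℝ.fromℕ-suc-positive n))

    ofReal*re : ∀ x z → x ℝ.* re z ℝ.≈ re (ofReal x * z)
    ofReal*re x (a , b) = solve 3 (λ x a b → x :* a := x :* a :- con 0ℤ :* b) ℝ.refl x a b

    ofReal*im : ∀ x z → x ℝ.* im z ℝ.≈ im (ofReal x * z)
    ofReal*im x (a , b) = solve 3 (λ x a b → x :* b := x :* b :+ con 0ℤ :* a) ℝ.refl x a b

    ·-cancelˡℂ : ∀ n {x y} → suc n ℂ.· 1ℂ * x ≈ suc n ℂ.· 1ℂ * y → x ≈ y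
    ·-cancelˡℂ n {x} {y} nx≈ny =
      ·-cancelˡ n (ℝ.trans (ofReal*re _ x) (ℝ.trans (proj₁ eq) (ℝ.sym (ofReal*re _ y)))) ,
      ·-cancelˡ n (ℝ.trans (ofReal*im _ x) (ℝ.trans (proj₂ eq) (ℝ.sym (ofReal*im _ y))))
      where
      eq : ofReal (ℝ.fromℕ (suc n)) * x ≈ ofReal (ℝ.fromℕ (suc n)) * y
      eq = ℂ.trans (ℂ.*-congʳ (ℂ.sym (·1ℂ (suc n)))) (ℂ.trans nx≈ny (ℂ.*-congʳ (·1ℂ (suc n))))

  ℝ-inverseFactorials : InverseFactorials ℝ.commutativeRing
  ℝ-inverseFactorials = record
    { 1/_! = 1/_! ; 1/0!≈1 = 1/0!≈1 ; 1/[1+n]! = 1/[1+n]! ; ·-cancelˡ = ·-cancelˡ }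

  ℂ-inverseFactorials : InverseFactorials commutativeRing
  ℂ-inverseFactorials = record
    { 1/_!      = ofReal ∘ 1/_!
    ; 1/0!≈1    = 1/0!≈1 , ℝ.refl
    ; 1/[1+n]!  = 1/[1+n]!ℂ
    ; ·-cancelˡ = ·-cancelˡℂ
    }

  module ℝSeries = ExponentialSeries ℝ.commutativeRing ℝ-inverseFactorials
  module ℂSeries = ExponentialSeries commutativeRing ℂ-inverseFactorials
  module ℝΣ = Convolution ℝ.commutativeRing

  partialSum : ℂ → ℕ → ℂ
  partialSum z = Σ< (expTerm z)

  Null : (ℕ → ℂ) → Set (c ⊔ ℓ₂)
  Null s = ℝ.Null (re ∘ s) × ℝ.Null (im ∘ s)

  opaque
    Null-+ : ∀ {s t} → Null s → Null t → Null (λ n → s n + t n)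
    Null-+ (re₁ , im₁) (re₂ , im₂) = ℝ.Null-+ re₁ re₂ , ℝ.Null-+ im₁ im₂

    Null-neg : ∀ {s} → Null s → Null (λ n → - s n)
    Null-neg (re₁ , im₁) = ℝ.Null-neg re₁ , ℝ.Null-neg im₁

    Null-* : ∀ {s t} → Null s → Null t → Null (λ n → s n * t n)
    Null-* (re₁ , im₁) (re₂ , im₂) =
      ℝ.Null-+ (ℝ.Null-* re₁ re₂) (ℝ.Null-neg (ℝ.Null-* im₁ im₂)) ,
      ℝ.Null-+ (ℝ.Null-* re₁ im₂) (ℝ.Null-* im₁ re₂)

    Null-scale : ∀ z {s} → Null s → Null (λ n → z * s n)
    Null-scale (a , b) (re₁ , im₁) =
      ℝ.Null-+ (ℝ.Null-scale a re₁) (ℝ.Null-neg (ℝ.Null-scale b im₁)) ,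
      ℝ.Null-+ (ℝ.Null-scale a im₁) (ℝ.Null-scale b re₁)

    Null-cong : ∀ {s t} → (∀ n → s n ≈ t n) → Null s → Null t
    Null-cong s≈t (re₁ , im₁) =
      ℝ.Null-cong (proj₁ ∘ s≈t) re₁ , ℝ.Null-cong (proj₂ ∘ s≈t) im₁

    Null-dominated : ∀ {s t} → (∀ n → ‖ s n ‖≤ t n) → ℝ.Null t → Null s
    Null-dominated ‖s‖≤t null-t =
      ℝ.Null-dominated (‖‖⇒re ∘ ‖s‖≤t) null-t , ℝ.Null-dominated (‖‖⇒im ∘ ‖s‖≤t) null-t

    Null-const : ∀ {z} → Null (λ _ → z) → z ≈ 0ℂ
    Null-const (re₁ , im₁) = ℝ.Null-const re₁ , ℝ.Null-const im₁

    partialSum-Null : ∀ z → Null (λ n → partialSum z n - exp z)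
    partialSum-Null z = ℝ.⟶⇒Null (proj₁ (isExp z)) , ℝ.⟶⇒Null (proj₂ (isExp z))

    re-Σ<-ofReal : ∀ {f : ℕ → ℂ} {g : ℕ → ℝ.Carrier} → (∀ i → re (f i) ℝ.≈ g i) →
                   ∀ n → re (Σ< f n) ℝ.≈ ℝΣ.Σ< g n
    re-Σ<-ofReal f≈g zero    = ℝ.refl
    re-Σ<-ofReal {f} {g} f≈g (suc n) =
      ℝ.+-cong (f≈g 0) (re-Σ<-ofReal {f ∘ suc} {g ∘ suc} (f≈g ∘ suc) n)

    -- The limit is supplied by the hypothesis on `exp` at a real argument, where the partial sums
    -- have the real series as real part. No estimate of factorials is involved.
    realSeries-Null : ∀ x → ℝ.Null (λ n → ℝΣ.Σ< (ℝSeries.term x) n ℝ.- re (exp (ofReal x)))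
    realSeries-Null x = ℝ.Null-cong
      (λ n → ℝ.+-congʳ (re-Σ<-ofReal {expTerm (ofReal x)} {ℝSeries.term x}
        (λ i → proj₁ (ℂ.trans (ℂ.*-congʳ (ofReal-^ x i)) (ofReal-* (x ℝ.^ i) (1/ i !)))) n))
      (proj₁ (partialSum-Null (ofReal x)))

    realSeries-tail-Null : ∀ x →
      ℝ.Null (λ n → ℝΣ.Σ< (ℝSeries.term x) (n ℕ.+ n) ℝ.- ℝΣ.Σ< (ℝSeries.term x) n)
    realSeries-tail-Null x = ℝ.Null-cong
      (λ n → solve 3 (λ s t l → s :- l :+ :- (t :- l) := s :- t) ℝ.refl _ _ _)
      (ℝ.Null-+
        (ℝ.Null-subsequence (λ n → n ℕ.+ n) (λ n → ℕ.m≤m+n n n) (realSeries-Null x))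
        (ℝ.Null-neg (realSeries-Null x)))

    1/!-nonneg : ∀ n → ℝ.0# ℝ.≤ 1/ n !
    1/!-nonneg n = ℝ.<-asym (ℝ.1/-positive (n !) {{n ℕ.!≢0}})

    ^-nonneg : ∀ {x} → ℝ.0# ℝ.≤ x → ∀ n → ℝ.0# ℝ.≤ x ℝ.^ n
    ^-nonneg 0≤x zero    = ℝ.<-asym ℝ.0<1
    ^-nonneg 0≤x (suc n) = ℝ.*-nonneg 0≤x (^-nonneg 0≤x n)

    term-nonneg : ∀ {x} → ℝ.0# ℝ.≤ x → ∀ n → ℝ.0# ℝ.≤ ℝSeries.term x n
    term-nonneg 0≤x n = ℝ.*-nonneg (^-nonneg 0≤x n) (1/!-nonneg n)

    term-bound : ∀ {z r} → ℝ.0# ℝ.≤ r → ‖ z ‖≤ r → ∀ n → ‖ expTerm z n ‖≤ ℝSeries.term r n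
    term-bound 0≤r ‖z‖≤r n = ‖‖-* (‖^‖ 0≤r ‖z‖≤r n) (‖ofReal‖ (1/!-nonneg n))

    partialSum-*-Null : ∀ w z →
      Null (λ n → partialSum w n * partialSum z n - partialSum (w + z) n)
    partialSum-*-Null w z with ‖‖-bounded w | ‖‖-bounded z
    ... | r , 0≤r , ‖w‖≤r | s , 0≤s , ‖z‖≤s = Null-cong
      (λ n → ℂ.+-congˡ (ℂ.-‿cong (ℂSeries.tri-term w z n)))
      (Null-dominated
        (λ n → ‖‖-weaken
          (ℝ.≤-reflexive (ℝ.+-cong (ℝSeries.tri-term r s (n ℕ.+ n)) (ℝ.-‿cong (ℝSeries.tri-term r s n))))
          (Σ<*Σ<-tri-bound-double (term-bound 0≤r ‖w‖≤r) (term-bound 0≤s ‖z‖≤s)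
            (term-nonneg 0≤r) (term-nonneg 0≤s) n))
        (realSeries-tail-Null (r ℝ.+ s)))

  opaque
    exp-+ : ∀ w z → exp (w + z) ≈ exp w * exp z
    exp-+ w z = ℂ.sym (x-y≈0⇒x≈y (Null-const (Null-cong
      (λ n → Identities.product-error commutativeRing (partialSum w n) (partialSum z n) (partialSum (w + z) n) _ _ _)
      (Null-+ (partialSum-*-Null w z)
        (Null-+ (Null-neg (Null-scale (exp z) (partialSum-Null w)))
          (Null-+ (Null-neg (Null-scale (exp w) (partialSum-Null z)))
            (Null-+ (Null-neg (Null-* (partialSum-Null w) (partialSum-Null z)))
              (partialSum-Null (w + z)))))))))

    -- `IsExp` speaks of each argument separately, so congruence is a statement about limits: equal
    -- arguments have equal partial sums.
    exp-cong : ∀ {w z} → w ≈ z → exp w ≈ exp z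
    exp-cong {w} {z} w≈z = x-y≈0⇒x≈y (Null-const (Null-cong
      (λ n → Identities.difference-error commutativeRing (partialSum z n) (exp w) (exp z))
      (Null-+ (partialSum-Null z) (Null-neg (Null-cong
        (λ n → ℂ.+-congʳ (Σ<-cong {expTerm w} {expTerm z} (λ i → ℂ.*-congʳ (^-congˡ i w≈z)) n)) (partialSum-Null w))))))

    exp-0 : exp 0ℂ ≈ 1ℂ
    exp-0 = ℂ.sym (x-y≈0⇒x≈y (
      eventually-const (λ n → ℂ.+-congʳ (partialSum-0 n)) (partialSum-Null 0ℂ)))
      where
      Σ<-0 : ∀ n → Σ< (λ _ → 0ℂ) n ≈ 0ℂ
      Σ<-0 zero    = ℂ.refl
      Σ<-0 (suc n) = ℂ.trans (ℂ.+-identityˡ _) (Σ<-0 n)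
      -- The empty partial sum is 0, so the constant value 1 starts only at index 1; hence the
      -- passage to the sequence shifted by `suc`.
      partialSum-0 : ∀ n → partialSum 0ℂ (suc n) ≈ 1ℂ
      partialSum-0 n = ℂ.trans (ℂ.+-cong
          (ℂ.trans (ℂ.*-identityˡ _) (1/0!≈1 , ℝ.refl))
          (ℂ.trans (Σ<-cong {expTerm 0ℂ ∘ suc} {λ _ → 0ℂ}
            (λ i → ℂ.trans (ℂ.*-congʳ (ℂ.zeroˡ (0ℂ ^ i))) (ℂ.zeroˡ (ofReal (1/ suc i !)))) n) (Σ<-0 n)))
        (ℂ.+-identityʳ 1ℂ)
      eventually-const : ∀ {s z} → (∀ n → s (suc n) ≈ z) → Null s → z ≈ 0ℂ
      eventually-const s≈z (re₁ , im₁) = Null-const (Null-cong s≈z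
        (ℝ.Null-subsequence suc ℕ.n≤1+n re₁ , ℝ.Null-subsequence suc ℕ.n≤1+n im₁))

  conj : ℂ → ℂ
  conj (x , y) = x , ℝ.- y

  opaque
    conj-* : ∀ w z → conj (w * z) ≈ conj w * conj z
    conj-* (a , b) (a′ , b′) =
      solve 4 (λ a b a′ b′ → a :* a′ :- b :* b′ := a :* a′ :- (:- b) :* (:- b′)) ℝ.refl a b a′ b′ ,
      solve 4 (λ a b a′ b′ → :- (a :* b′ :+ b :* a′) := a :* (:- b′) :+ (:- b) :* a′) ℝ.refl a b a′ b′

    conj-ofReal : ∀ x → conj (ofReal x) ≈ ofReal x
    conj-ofReal x = ℝ.refl , ℝ.-0#≈0#

    conj-^ : ∀ z n → conj (z ^ n) ≈ conj z ^ n
    conj-^ z zero    = conj-ofReal ℝ.1#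
    conj-^ z (suc n) = ℂ.trans (conj-* z (z ^ n)) (ℂ.*-congˡ (conj-^ z n))

    conj-Σ< : ∀ {f g : ℕ → ℂ} → (∀ i → conj (f i) ≈ g i) → ∀ n → conj (Σ< f n) ≈ Σ< g n
    conj-Σ< f≈g zero    = conj-ofReal ℝ.0#
    conj-Σ< {f} {g} f≈g (suc n) = ℂ.trans
      (ℝ.refl , solve 2 (λ x y → :- (x :+ y) := :- x :+ :- y) ℝ.refl _ _)
      (ℂ.+-cong (f≈g 0) (conj-Σ< {f ∘ suc} {g ∘ suc} (f≈g ∘ suc) n))

    -- The coefficients of the series are real. At an imaginary argument this makes the conjugate of
    -- `exp` its inverse, which yields cos² + sin² = 1.
    exp-conj : ∀ z → exp (conj z) ≈ conj (exp z)
    exp-conj z = x-y≈0⇒x≈y (Null-const (Null-cong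
      (λ n → Identities.difference-error commutativeRing (conj (partialSum z n)) (exp (conj z)) (conj (exp z)))
      (Null-+ conj-Null (Null-neg (Null-cong (λ n → ℂ.+-congʳ (ℂ.sym (conj-partialSum n)))
        (partialSum-Null (conj z)))))))
      where
      conj-partialSum : ∀ n → conj (partialSum z n) ≈ partialSum (conj z) n
      conj-partialSum = conj-Σ< {expTerm z} {expTerm (conj z)} (λ i → ℂ.trans (conj-* (z ^ i) (ofReal (1/ i !)))
        (ℂ.*-cong (conj-^ z i) (conj-ofReal (1/ i !))))
      conj-Null : Null (λ n → conj (partialSum z n) - conj (exp z))
      conj-Null = proj₁ (partialSum-Null z) , ℝ.Null-cong
        (λ n → solve 2 (λ x y → :- (x :- y) := :- x :- :- y) ℝ.refl _ _)
        (ℝ.Null-neg (proj₂ (partialSum-Null z)))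

-- Products of distinct primes and the Chinese remainder theorem for exponents.

module PrimeProducts where
  open import Data.Nat using (_+_; _*_; _<_)

  ∣-respʳ : ∀ {d m n} → m ≡ n → d ∣ m → d ∣ n
  ∣-respʳ ≡.refl d∣m = d∣m

  ∏ : ∀ {t} → Vector ℕ t → ℕ
  ∏ = foldr _*_ 1

  prime∤∏ : ∀ {t q} (p : Vector ℕ t) → Prime q → (∀ j → Prime (p j)) → (∀ j → q ≢ p j) → ¬ q ∣ ∏ p
  prime∤∏ {zero}  p q-prime p-prime q≢p q∣1 =
    ¬prime[1] (≡.subst Prime (∣.∣1⇒≡1 q∣1) q-prime)
  prime∤∏ {suc t} p q-prime p-prime q≢p q∣∏ with euclidsLemma (p Fin.zero) _ q-prime q∣∏
  ... | inj₂ q∣∏′ = prime∤∏ (p ∘ Fin.suc) q-prime (p-prime ∘ Fin.suc) (q≢p ∘ Fin.suc) q∣∏′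
  ... | inj₁ q∣p₀ with prime⇒irreducible (p-prime Fin.zero) q∣p₀
  ... | inj₁ q≡1  = ¬prime[1] (≡.subst Prime q≡1 q-prime)
  ... | inj₂ q≡p₀ = q≢p Fin.zero q≡p₀

  ∏-nonZero : ∀ {t} (p : Vector ℕ t) → (∀ j → Prime (p j)) → ℕ.NonZero (∏ p)
  ∏-nonZero {zero}  p p-prime = _
  ∏-nonZero {suc t} p p-prime =
    ℕ.m*n≢0 _ _ {{prime⇒nonZero (p-prime Fin.zero)}} {{∏-nonZero (p ∘ Fin.suc) (p-prime ∘ Fin.suc)}}

  prime∤⇒coprime : ∀ {p n} → Prime p → ¬ p ∣ n → Coprime p n
  prime∤⇒coprime p-prime p∤n (d∣p , d∣n) with prime⇒irreducible p-prime d∣p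
  ... | inj₁ d≡1    = d≡1
  ... | inj₂ ≡.refl = contradiction d∣n p∤n

  head-coprime : ∀ {t} (p : Vector ℕ (suc t)) → (∀ j → Prime (p j)) → Injective _≡_ _≡_ p →
                 Coprime (p Fin.zero) (∏ (p ∘ Fin.suc))
  head-coprime p p-prime p-inj = prime∤⇒coprime (p-prime Fin.zero)
    (prime∤∏ (p ∘ Fin.suc) (p-prime Fin.zero) (p-prime ∘ Fin.suc)
      (λ j p₀≡ → contradiction (p-inj p₀≡) λ ()))

  ∣-coprime : ∀ {d m n} → d ∣ m → Coprime m n → Coprime d n
  ∣-coprime d∣m m⊥n (e∣d , e∣n) = m⊥n (∣.∣-trans e∣d d∣m , e∣n)

  coprime-*ʳ : ∀ {x m n} → Coprime x m → Coprime x n → Coprime x (m * n)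
  coprime-*ʳ x⊥m x⊥n (d∣x , d∣mn) = x⊥n (d∣x , coprime-divisor (∣-coprime d∣x x⊥m) d∣mn)

  -- The Chinese remainder theorem for exponents: ζ_p ^ i · ζ_m ^ s = ζ_{pm} ^ (i m + s p).
  combine-coprime : ∀ {p m i s} → Prime p → Coprime p m → 0 < i → i < p → Coprime s m →
                    Coprime (i * m + s * p) (p * m)
  combine-coprime {p} {m} {i} {s} p-prime p⊥m 0<i i<p s⊥m = coprime-*ʳ
    (λ (d∣x , d∣p) → prime⇒coprime p-prime {{ℕ.>-nonZero 0<i}} i<p
      (d∣p , coprime-divisor (∣-coprime d∣p p⊥m) (∣-respʳ (ℕ.*-comm i m)
        (∣.∣m+n∣m⇒∣n (∣-respʳ (ℕ.+-comm (i * m) (s * p)) d∣x) (∣.∣n⇒∣m*n s d∣p)))))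
    (λ (d∣x , d∣m) → s⊥m
      (coprime-divisor (∣-coprime d∣m (Coprimality.sym p⊥m)) (∣-respʳ (ℕ.*-comm s p)
        (∣.∣m+n∣m⇒∣n d∣x (∣.∣n⇒∣m*n i d∣m))) , d∣m))

  private
    open ℕSolver.+-*-Solver

    -- Bézout's identity multiplied by `r`, with `i` reduced modulo `p`. In natural numbers a
    -- negative coefficient is replaced by a positive one in its residue class, at the price of the
    -- multiple `c` of `p * m`, which an exponent of `ζ (p * m)` does not notice.
    split : ∀ p m r .{{_ : ℕ.NonZero p}} .{{_ : ℕ.NonZero m}} → Coprime m p →
            ∃₂ λ i s → i < p × ∃ λ c → i * m + s * p ≡ r + c * (p * m)
    split p@(suc p′) m@(suc m′) r m⊥p with coprime-Bézout m⊥p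
    -- Here `x` is the inverse of `m` modulo `p`, and the coefficient -ry of `p` becomes
    -- `r * y * m′`, since m′ = m - 1.
    ... | Bézout.+- x y 1+yp≡xm = i , r * y * m′ + q * m , DivMod.m%n<n a p , r * y , (begin
        i * m + (r * y * m′ + q * m) * p
          ≡⟨ solve 5 (λ i m′ q p ry → i :* (con 1 :+ m′) :+ (ry :* m′ :+ q :* (con 1 :+ m′)) :* p
               := (i :+ q :* p) :* (con 1 :+ m′) :+ ry :* m′ :* p) ≡.refl i m′ q p (r * y) ⟩
        (i + q * p) * m + r * y * m′ * p
          ≡⟨ ≡.cong (λ b → b * m + r * y * m′ * p) (DivMod.m≡m%n+[m/n]*n a p) ⟨
        r * x * m + r * y * m′ * p
          ≡⟨ ≡.cong (_+ r * y * m′ * p) (≡.trans (ℕ.*-assoc r x m) (≡.cong (r *_) (≡.sym 1+yp≡xm))) ⟩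
        r * (1 + y * p) + r * y * m′ * p
          ≡⟨ solve 4 (λ r y m′ p → r :* (con 1 :+ y :* p) :+ r :* y :* m′ :* p
               := r :+ r :* y :* (p :* (con 1 :+ m′))) ≡.refl r y m′ p ⟩
        r + r * y * (p * m) ∎)
      where
      open ≡.≡-Reasoning
      a i q : ℕ
      a = r * x
      i = a DivMod.% p
      q = a DivMod./ p
    -- Here the inverse of `m` modulo `p` is -x, represented by `x * p′`. Modulo `m`, where yp is 1
    -- and `m′` is -1, the sum `r + r * y * p′ * m′` is the required `r * y`.
    ... | Bézout.-+ x y 1+xm≡yp = i , q * m + r + r * y * p′ * m′ , DivMod.m%n<n a p , r * y * p′ , (begin
        i * m + (q * m + r + r * y * p′ * m′) * p
          ≡⟨ solve 6 (λ i m q p′ r e → i :* m :+ (q :* m :+ r :+ e) :* (con 1 :+ p′)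
               := (i :+ q :* (con 1 :+ p′)) :* m :+ (r :+ e) :* (con 1 :+ p′)) ≡.refl i m q p′ r (r * y * p′ * m′) ⟩
        (i + q * p) * m + (r + r * y * p′ * m′) * p
          ≡⟨ ≡.cong (λ b → b * m + (r + r * y * p′ * m′) * p) (DivMod.m≡m%n+[m/n]*n a p) ⟨
        r * x * p′ * m + (r + r * y * p′ * m′) * p
          ≡⟨ solve 6 (λ r x p′ m y m′ → r :* x :* p′ :* m :+ (r :+ r :* y :* p′ :* m′) :* (con 1 :+ p′)
               := r :* (con 1 :+ x :* m) :* p′ :+ r :+ r :* y :* p′ :* m′ :* (con 1 :+ p′)) ≡.refl r x p′ m y m′ ⟩
        r * (1 + x * m) * p′ + r + r * y * p′ * m′ * p
          ≡⟨ ≡.cong (λ b → r * b * p′ + r + r * y * p′ * m′ * p) 1+xm≡yp ⟩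
        r * (y * p) * p′ + r + r * y * p′ * m′ * p
          ≡⟨ solve 5 (λ r y p p′ m′ → r :* (y :* p) :* p′ :+ r :+ r :* y :* p′ :* m′ :* p
               := r :+ r :* y :* p′ :* (p :* (con 1 :+ m′))) ≡.refl r y p p′ m′ ⟩
        r + r * y * p′ * (p * m) ∎)
      where
      open ≡.≡-Reasoning
      a i q : ℕ
      a = r * x * p′
      i = a DivMod.% p
      q = a DivMod./ p

  -- The converse of `combine-coprime`: a common divisor of `s` and `m` divides `i * m + s * p` and
  -- `p * m`, hence also `r`.
  split-coprime : ∀ p m r .{{_ : ℕ.NonZero m}} → Prime p → Coprime p m → Coprime r (p * m) →
    ∃₂ λ i s → 0 < i × i < p × Coprime s m × ∃ λ c → i * m + s * p ≡ r + c * (p * m)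
  split-coprime p m r p-prime p⊥m r⊥pm
    with split p m r {{prime⇒nonZero p-prime}} (Coprimality.sym p⊥m)
  -- With i = 0 the prime `p` would divide both `r` and `p * m`, so it would be 1.
  ... | zero  , s , i<p , c , sp≡ =
    contradiction (≡.subst Prime (r⊥pm (∣⇒∣r (∣.n∣m*n s) (∣.m∣m*n m) , ∣.m∣m*n m)) p-prime) ¬prime[1]
    where
    ∣⇒∣r : ∀ {d} → d ∣ s * p → d ∣ p * m → d ∣ r
    ∣⇒∣r d∣sp d∣pm = ∣.∣m+n∣m⇒∣n
      (∣-respʳ (≡.trans sp≡ (ℕ.+-comm r _)) d∣sp) (∣.∣n⇒∣m*n c d∣pm)
  ... | i@(suc _) , s , i<p , c , eq = i , s , ℕ.s≤s ℕ.z≤n , i<p ,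
    (λ (d∣s , d∣m) → r⊥pm
      (∣.∣m+n∣m⇒∣n (∣-respʳ (≡.trans eq (ℕ.+-comm r _))
          (∣.∣m∣n⇒∣m+n (∣.∣n⇒∣m*n i d∣m) (∣.∣m⇒∣m*n p d∣s)))
        (∣.∣n⇒∣m*n c (∣.∣n⇒∣m*n p d∣m)) ,
       ∣.∣n⇒∣m*n p d∣m)) ,
    c , eq

-- Values of `exp` on the imaginary axis, roots of unity and principal roots.

module Trigonometry {c ℓ₁ ℓ₂} (R : RealNumbers c ℓ₁ ℓ₂)
  (exp : ComplexNumbers.ℂ R → ComplexNumbers.ℂ R) (isExp : ComplexNumbers.IsExp R exp)
  (π : RealNumbers.Carrier R) (isPi : ComplexNumbers.IsPi R exp π) where
  open ComplexNumbers R
  open ComplexExponential R exp isExp using (exp-+; exp-cong; exp-0; exp-conj; conj; ofReal-^)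
  open ComplexField R using (commutativeRing; heytingField)
  private
    module ℂ where
      open CommutativeRing commutativeRing public
      open CommutativeExp commutativeSemiring public using (^-distrib-*; ^-congˡ; ^-homo-*)
      open HeytingFieldProperties heytingField public
    module ℝ where
      open RealNumbers R public
      open RealProperties R public
  open ℝ using (solve; _:=_; _:+_; _:*_; _:-_; :-_; con)
  open IsPi isPi renaming (positive to 0<π)
  open RootsOfUnity exp π
  open HeytingField heytingField using (_#_)

  cis : ℝ.Carrier → ℂ
  cis θ = exp (i· θ)

  opaque
    cis-cong : ∀ {α β} → α ℝ.≈ β → cis α ≈ cis β
    cis-cong α≈β = exp-cong (ℝ.refl , α≈β)

    cis-+ : ∀ α β → cis (α ℝ.+ β) ≈ cis α * cis β
    cis-+ α β = ℂ.trans (exp-cong (ℝ.sym (ℝ.+-identityˡ ℝ.0#) , ℝ.refl)) (exp-+ (i· α) (i· β))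

    cis-0 : cis ℝ.0# ≈ 1ℂ
    cis-0 = exp-0

    cis-· : ∀ n θ → cis (ℝ.fromℕ n ℝ.* θ) ≈ cis θ ^ n
    cis-· zero    θ = ℂ.trans (cis-cong (ℝ.zeroˡ θ)) cis-0
    cis-· (suc n) θ = ℂ.trans
      (cis-cong (solve 2 (λ n θ → (con 1ℤ :+ n) :* θ := θ :+ n :* θ) ℝ.refl (ℝ.fromℕ n) θ))
      (ℂ.trans (cis-+ θ _) (ℂ.*-congˡ (cis-· n θ)))

    cos²+sin²≈1 : ∀ θ → re (cis θ) ℝ.* re (cis θ) ℝ.+ im (cis θ) ℝ.* im (cis θ) ℝ.≈ ℝ.1#
    cos²+sin²≈1 θ = ℝ.trans
      (solve 2 (λ x y → x :* x :+ y :* y := x :* x :- y :* (:- y)) ℝ.refl (re (cis θ)) (im (cis θ)))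
      (proj₁ (begin
        cis θ * conj (cis θ)     ≈⟨ ℂ.*-congˡ (exp-conj (i· θ)) ⟨
        cis θ * cis (ℝ.- θ)      ≈⟨ cis-+ θ (ℝ.- θ) ⟨
        cis (θ ℝ.+ ℝ.- θ)        ≈⟨ cis-cong (ℝ.-‿inverseʳ θ) ⟩
        cis ℝ.0#                 ≈⟨ cis-0 ⟩
        1ℂ                       ∎))
      where open SetoidReasoning ℂ.setoid

    -- π / 2 lies in (0, π), so 0 = sin π = 2 sin (π / 2) cos (π / 2) forces cos (π / 2) = 0.
    cis-π : cis π ≈ - 1ℂ
    cis-π with ℝ.half 0<π
    ... | h , 0<h , h+h≈π = ℂ.trans cis-π≈ (cos , sin)
      where
      x y : ℝ.Carrier
      x = re (cis h)
      y = im (cis h)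

      cis-π≈ : cis π ≈ cis h * cis h
      cis-π≈ = ℂ.trans (cis-cong (ℝ.sym h+h≈π)) (cis-+ h h)

      h<π : h ℝ.< π
      h<π = ℝ.<-respʳ h+h≈π (ℝ.<-respˡ (ℝ.+-identityˡ h) (ℝ.+-monoˡ-< h 0<h))

      x+x≈0 : x ℝ.+ x ℝ.≈ ℝ.0#
      x+x≈0 = ℝ.x*y≈0⇒y≈0 (least h 0<h h<π) (ℝ.trans
        (solve 2 (λ x y → y :* (x :+ x) := x :* y :+ y :* x) ℝ.refl x y)
        (ℝ.trans (ℝ.sym (proj₂ cis-π≈)) zero-sin))

      cos : x ℝ.* x ℝ.- y ℝ.* y ℝ.≈ ℝ.- ℝ.1#
      cos = begin
        x ℝ.* x ℝ.- y ℝ.* y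
          ≈⟨ solve 2 (λ x y → x :* x :- y :* y := (x :+ x) :* x :- (x :* x :+ y :* y)) ℝ.refl x y ⟩
        (x ℝ.+ x) ℝ.* x ℝ.- (x ℝ.* x ℝ.+ y ℝ.* y)
          ≈⟨ ℝ.+-cong (ℝ.trans (ℝ.*-congʳ x+x≈0) (ℝ.zeroˡ x)) (ℝ.-‿cong (cos²+sin²≈1 h)) ⟩
        ℝ.0# ℝ.- ℝ.1#
          ≈⟨ ℝ.+-identityˡ _ ⟩
        ℝ.- ℝ.1# ∎
        where open SetoidReasoning ℝ.setoid

      sin : x ℝ.* y ℝ.+ y ℝ.* x ℝ.≈ ℝ.- ℝ.0#
      sin = ℝ.trans (ℝ.sym (proj₂ cis-π≈)) (ℝ.trans zero-sin (ℝ.sym ℝ.-0#≈0#))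

    cis-2π : cis (π ℝ.+ π) ≈ 1ℂ
    cis-2π = ℂ.trans (cis-+ π π) (ℂ.trans (ℂ.*-cong cis-π cis-π)
      (solve 0 ((:- con 1ℤ) :* (:- con 1ℤ) :- (:- con 0ℤ) :* (:- con 0ℤ) := con 1ℤ) ℝ.refl ,
       solve 0 ((:- con 1ℤ) :* (:- con 0ℤ) :+ (:- con 0ℤ) :* (:- con 1ℤ) := con 0ℤ) ℝ.refl))

    -- re (cis 2θ) = 1 - 2 (sin θ)²
    cis-#1 : ∀ {θ} → ℝ.0# ℝ.< θ → θ ℝ.< π → cis (θ ℝ.+ θ) # 1ℂ
    cis-#1 {θ} 0<θ θ<π = inj₁ (inj₁ (ℝ.<-respˡ (ℝ.sym (proj₁ (cis-+ θ θ)))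
      (ℝ.0<y-x⇒x<y (ℝ.<-respʳ (ℝ.sym 1-re≈) (ℝ.<-respˡ (ℝ.+-identityˡ _)
        (ℝ.+-mono-<-≤ 0<y² (ℝ.<-asym 0<y²)))))))
      where
      x y : ℝ.Carrier
      x = re (cis θ)
      y = im (cis θ)

      0<y² : ℝ.0# ℝ.< y ℝ.* y
      0<y² = ℝ.square-positive (least θ 0<θ θ<π)

      1-re≈ : ℝ.1# ℝ.- (x ℝ.* x ℝ.- y ℝ.* y) ℝ.≈ y ℝ.* y ℝ.+ y ℝ.* y
      1-re≈ = ℝ.trans (ℝ.+-congʳ (ℝ.sym (cos²+sin²≈1 θ)))
        (solve 2 (λ x y → x :* x :+ y :* y :- (x :* x :- y :* y) := y :* y :+ y :* y) ℝ.refl x y)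

    cis-·[θ*1/] : ∀ n .{{_ : ℕ.NonZero n}} θ → cis (θ ℝ.* ℝ.1/ n) ^ n ≈ cis θ
    cis-·[θ*1/] n θ = ℂ.trans (ℂ.sym (cis-· n _)) (cis-cong (ℝ.fromℕ*[x*1/] n θ))

    ζ^n≈1 : ∀ n .{{_ : ℕ.NonZero n}} → ζ n ^ n ≈ 1ℂ
    ζ^n≈1 n = ℂ.trans (cis-·[θ*1/] n (π ℝ.+ π)) cis-2π

    -- With θ = jπ/n, strictly between 0 and π, the power is `cis (θ + θ)`, to which `cis-#1`
    -- applies.
    ζ^j#1 : ∀ n j → 0 ℕ.< j → j ℕ.< n → ζ n ^ j # 1ℂ
    ζ^j#1 n j 0<j j<n = ℂ.#-congʳ
      (ℂ.trans (cis-cong (solve 3 (λ j π r → j :* (π :* r) :+ j :* (π :* r) := j :* ((π :+ π) :* r))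
         ℝ.refl (ℝ.fromℕ j) π (ℝ.1/ n))) (cis-· j _))
      (cis-#1 (ℝ.*-positive (ℝ.fromℕ-mono-< 0<j) 0<π/n)
        (ℝ.<-respʳ (ℝ.fromℕ*[x*1/] n π)
          (ℝ.<-respˡ (ℝ.*-comm _ _) (ℝ.<-respʳ (ℝ.*-comm _ _)
            (ℝ.*-monoˡ-< 0<π/n (ℝ.fromℕ-mono-< j<n))))))
      where
      instance
        n≢0 : ℕ.NonZero n
        n≢0 = ℕ.>-nonZero (ℕ.≤-<-trans ℕ.z≤n j<n)
      0<π/n : ℝ.0# ℝ.< π ℝ.* ℝ.1/ n
      0<π/n = ℝ.*-positive 0<π (ℝ.1/-positive n)

    ζ[m*n]^m≈ζn : ∀ m n .{{_ : ℕ.NonZero m}} .{{_ : ℕ.NonZero n}} → ζ (m ℕ.* n) ^ m ≈ ζ n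
    ζ[m*n]^m≈ζn m n = ℂ.trans (ℂ.sym (cis-· m _)) (cis-cong (begin
      ℝ.fromℕ m ℝ.* ((π ℝ.+ π) ℝ.* ℝ.1/ (m ℕ.* n))
        ≈⟨ solve 3 (λ m x r → m :* (x :* r) := x :* (m :* r)) ℝ.refl _ _ _ ⟩
      (π ℝ.+ π) ℝ.* (ℝ.fromℕ m ℝ.* ℝ.1/ (m ℕ.* n))
        ≈⟨ ℝ.*-congˡ (ℝ.1/-unique n (begin
             ℝ.fromℕ n ℝ.* (ℝ.fromℕ m ℝ.* ℝ.1/ (m ℕ.* n))
               ≈⟨ solve 3 (λ n m r → n :* (m :* r) := m :* n :* r) ℝ.refl _ _ _ ⟩
             ℝ.fromℕ m ℝ.* ℝ.fromℕ n ℝ.* ℝ.1/ (m ℕ.* n)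
               ≈⟨ ℝ.*-congʳ (ℝ.×1-homo-* m n) ⟨
             ℝ.fromℕ (m ℕ.* n) ℝ.* ℝ.1/ (m ℕ.* n)
               ≈⟨ ℝ.fromℕ*1/ (m ℕ.* n) {{ℕ.m*n≢0 m n}} ⟩
             ℝ.1# ∎)) ⟩
      (π ℝ.+ π) ℝ.* ℝ.1/ n ∎))
      where open SetoidReasoning ℝ.setoid

    principalRoot^k : ∀ {k y w} .{{_ : ℕ.NonZero k}} → IsPrincipalRoot k y w → w ^ k ≈ y
    principalRoot^k {k} {y} {w} isRoot = begin
      w ^ k
        ≈⟨ ℂ.^-congˡ k root ⟩
      (ofReal rootModulus * cis (arg ℝ.* ℝ.1/ k)) ^ k
        ≈⟨ ℂ.^-distrib-* _ _ k ⟩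
      ofReal rootModulus ^ k * cis (arg ℝ.* ℝ.1/ k) ^ k
        ≈⟨ ℂ.*-cong (ℂ.trans (ofReal-^ rootModulus k) (rootModulus^k , ℝ.refl)) (cis-·[θ*1/] k arg) ⟩
      ofReal modulus * cis arg
        ≈⟨ polar ⟨
      y ∎
      where
      open IsPrincipalRoot isRoot
      open SetoidReasoning ℂ.setoid

  private
    module PrincipalArgument (p j : ℕ) (j<p : j ℕ.< p) where
      instance
        p≢0 : ℕ.NonZero p
        p≢0 = ℕ.>-nonZero (ℕ.≤-<-trans ℕ.z≤n j<p)

      u ψ : ℝ.Carrier
      u = π ℝ.* ℝ.1/ p
      ψ = ℝ.fromℕ (j ℕ.+ j) ℝ.* u

      0<u : ℝ.0# ℝ.< u
      0<u = ℝ.*-positive 0<π (ℝ.1/-positive p)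

      p·u≈π : ℝ.fromℕ p ℝ.* u ℝ.≈ π
      p·u≈π = ℝ.fromℕ*[x*1/] p π

      u*-mono-≤ : ∀ {m n} → m ℕ.≤ n → ℝ.fromℕ m ℝ.* u ℝ.≤ ℝ.fromℕ n ℝ.* u
      u*-mono-≤ {m} {n} m≤n = ℝ.≤-trans (ℝ.≤-reflexive (ℝ.*-comm (ℝ.fromℕ m) u))
        (ℝ.≤-trans (ℝ.*-monoˡ-≤ (ℝ.<-asym 0<u) (ℝ.fromℕ-mono-≤ m≤n))
          (ℝ.≤-reflexive (ℝ.*-comm u (ℝ.fromℕ n))))

      u*-mono-< : ∀ {m n} → m ℕ.< n → ℝ.fromℕ m ℝ.* u ℝ.< ℝ.fromℕ n ℝ.* u
      u*-mono-< {m} {n} m<n = ℝ.<-respˡ (ℝ.*-comm u (ℝ.fromℕ m)) (ℝ.<-respʳ (ℝ.*-comm u (ℝ.fromℕ n))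
        (ℝ.*-monoˡ-< 0<u (ℝ.fromℕ-mono-< m<n)))

      0≤ψ : ℝ.0# ℝ.≤ ψ
      0≤ψ = ℝ.*-nonneg (ℝ.fromℕ-nonneg (j ℕ.+ j)) (ℝ.<-asym 0<u)

      ζ^j≈ : ζ p ^ j ≈ cis ψ
      ζ^j≈ = ℂ.trans (ℂ.sym (cis-· j _)) (cis-cong (ℝ.trans
        (solve 3 (λ j π r → j :* ((π :+ π) :* r) := (j :+ j) :* (π :* r)) ℝ.refl (ℝ.fromℕ j) π (ℝ.1/ p))
        (ℝ.*-congʳ (ℝ.sym (ℝ.×-homo-+ ℝ.1# j j)))))

  opaque
    -- The angle ψ = 2πj/p lies in [0, 2π) and is lowered by 2π if it exceeds π. Comparing 2j with p
    -- decides this without comparing reals. The case 2j = p falls under the first branch and gives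
    -- π, the included endpoint, while p < 2j keeps the lowered angle strictly above -π.
    principalArgument : ∀ p j → j ℕ.< p →
      ∃ λ θ → (ℝ.- π ℝ.< θ) × (θ ℝ.≤ π) × ζ p ^ j ≈ cis θ
    principalArgument p j j<p with j ℕ.+ j ℕ.≤? p
    ... | yes 2j≤p = ψ , ℝ.<-≤-trans (ℝ.0<x⇒-x<0 0<π) 0≤ψ , ψ≤π , ζ^j≈
      where
      open PrincipalArgument p j j<p
      ψ≤π : ψ ℝ.≤ π
      ψ≤π = ℝ.≤-trans (u*-mono-≤ 2j≤p) (ℝ.≤-reflexive p·u≈π)
    ... | no 2j≰p = ψ ℝ.- (π ℝ.+ π) , -π<θ , ℝ.≤-trans θ≤0 (ℝ.<-asym 0<π) , (begin
        ζ p ^ j                               ≈⟨ ζ^j≈ ⟩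
        cis ψ                                 ≈⟨ cis-cong (solve 2 (λ a b → a := a :- b :+ b) ℝ.refl ψ (π ℝ.+ π)) ⟩
        cis (ψ ℝ.- (π ℝ.+ π) ℝ.+ (π ℝ.+ π))   ≈⟨ cis-+ _ _ ⟩
        cis (ψ ℝ.- (π ℝ.+ π)) * cis (π ℝ.+ π) ≈⟨ ℂ.*-congˡ cis-2π ⟩
        cis (ψ ℝ.- (π ℝ.+ π)) * 1ℂ            ≈⟨ ℂ.*-identityʳ _ ⟩
        cis (ψ ℝ.- (π ℝ.+ π))                 ∎)
      where
      open PrincipalArgument p j j<p
      open SetoidReasoning ℂ.setoid
      π<ψ : π ℝ.< ψ
      π<ψ = ℝ.<-respˡ p·u≈π (u*-mono-< (ℕ.≰⇒> 2j≰p))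
      -π<θ : ℝ.- π ℝ.< ψ ℝ.- (π ℝ.+ π)
      -π<θ = ℝ.<-respˡ (solve 1 (λ a → a :- (a :+ a) := :- a) ℝ.refl π)
        (ℝ.+-monoˡ-< (ℝ.- (π ℝ.+ π)) π<ψ)
      ψ≤2π : ψ ℝ.≤ π ℝ.+ π
      ψ≤2π = ℝ.≤-trans (u*-mono-≤ (ℕ.+-mono-≤ (ℕ.<⇒≤ j<p) (ℕ.<⇒≤ j<p)))
        (ℝ.≤-reflexive (ℝ.trans (ℝ.*-congʳ (ℝ.×-homo-+ ℝ.1# p p))
          (ℝ.trans (ℝ.distribʳ u (ℝ.fromℕ p) (ℝ.fromℕ p)) (ℝ.+-cong p·u≈π p·u≈π))))
      θ≤0 : ψ ℝ.- (π ℝ.+ π) ℝ.≤ ℝ.0#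
      θ≤0 = ℝ.≤-trans (ℝ.+-mono-≤ ψ≤2π (ℝ.≤-refl {ℝ.- (π ℝ.+ π)})) (ℝ.≤-reflexive (ℝ.-‿inverseʳ _))

    principalRoot-cis : ∀ k {y θ} → ℝ.- π ℝ.< θ → θ ℝ.≤ π → y ≈ cis θ →
                        IsPrincipalRoot k y (ofReal ℝ.1# * cis (θ ℝ.* ℝ.1/ k))
    principalRoot-cis k {y} {θ} -π<θ θ≤π y≈cis = record
      { modulus            = ℝ.1#
      ; rootModulus        = ℝ.1#
      ; arg                = θ
      ; modulus-nonneg     = ℝ.<-asym ℝ.0<1
      ; modulus²           = ℝ.trans (ℝ.*-identityˡ ℝ.1#) (ℝ.trans (ℝ.sym (cos²+sin²≈1 θ)) (ℝ.sym
          (ℝ.+-cong (ℝ.*-cong (proj₁ y≈cis) (proj₁ y≈cis)) (ℝ.*-cong (proj₂ y≈cis) (proj₂ y≈cis)))))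
      ; -π<arg             = -π<θ
      ; arg≤π              = θ≤π
      ; polar              = ℂ.trans y≈cis (ℂ.sym (ℂ.*-identityˡ _))
      ; rootModulus-nonneg = ℝ.<-asym ℝ.0<1
      ; rootModulus^k      = 1^n≈1 k
      ; root               = ℂ.refl
      }
      where
      1^n≈1 : ∀ n → ℝ.1# ℝ.^ n ℝ.≈ ℝ.1#
      1^n≈1 zero    = ℝ.refl
      1^n≈1 (suc n) = ℝ.trans (ℝ.*-identityˡ _) (1^n≈1 n)

    -- Positivity of `k` makes the `k`th power of the root modulus 0; for exponent 0 it would be 1.
    -- The argument is arbitrary, and 0 lies in the required interval.
    principalRoot-0 : ∀ k .{{_ : ℕ.NonZero k}} → IsPrincipalRoot k 0ℂ 0ℂ
    principalRoot-0 (suc k) = record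
      { modulus            = ℝ.0#
      ; rootModulus        = ℝ.0#
      ; arg                = ℝ.0#
      ; modulus-nonneg     = ℝ.≤-refl {ℝ.0#}
      ; modulus²           = ℝ.sym (ℝ.trans (ℝ.+-congˡ (ℝ.zeroˡ ℝ.0#)) (ℝ.+-identityʳ _))
      ; -π<arg             = ℝ.0<x⇒-x<0 0<π
      ; arg≤π              = ℝ.<-asym 0<π
      ; polar              = ℂ.sym (ℂ.zeroˡ (cis ℝ.0#))
      ; rootModulus-nonneg = ℝ.≤-refl {ℝ.0#}
      ; rootModulus^k      = ℝ.zeroˡ _
      ; root               = ℂ.sym (ℂ.zeroˡ (cis (ℝ.0# ℝ.* ℝ.1/ suc k)))
      }

    principalRoot-ζ* : ∀ k .{{_ : ℕ.NonZero k}} p j → ∃ λ w → IsPrincipalRoot k (ζ*-entry p j) w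
    principalRoot-ζ* k p Fin.zero      = 0ℂ , principalRoot-0 k
    principalRoot-ζ* k p j@(Fin.suc _) with principalArgument p (toℕ j) (Fin.toℕ<n j)
    ... | θ , -π<θ , θ≤π , ζ^j≈ = _ , principalRoot-cis k -π<θ θ≤π ζ^j≈

    -- This shows that the vectors over which the equivalence quantifies exist, so that it does not
    -- hold vacuously.
    principalRootVec-ζ* : ∀ k .{{_ : ℕ.NonZero k}} p → ∃ λ v → IsPrincipalRootVec k (ζ⃗* p) v
    principalRootVec-ζ* k p =
      Vec.tabulate (proj₁ ∘ principalRoot-ζ* k p) ,
      Pointwise.tabulate⁺ (proj₂ ∘ principalRoot-ζ* k p)

-- Entries of iterated Kronecker products.

module KroneckerProduct {c ℓ₁ ℓ₂} (R : RealNumbers c ℓ₁ ℓ₂) where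
  open ComplexNumbers R
  open CommutativeRing (ComplexField.commutativeRing R)
    using (refl; sym; trans; *-assoc; *-congˡ; *-identityʳ)

  Any-⊗⁺ : ∀ {p a b} {P : ℂ → Set p} {x : Vec ℂ a} {y : Vec ℂ b} →
           VecAny.Any (λ s → ∃ λ i → P (s * Vec.lookup y i)) x → VecAny.Any P (x ⊗ y)
  Any-⊗⁺ {y = y} any = VecAny.concat⁺ (VecAny.map⁺ (VecAny.map (λ (i , Ps) →
    VecAny.map⁺ (lookup⁺ y i Ps)) any))
    where
    lookup⁺ : ∀ {p b} {P : ℂ → Set p} (y : Vec ℂ b) i → P (Vec.lookup y i) → VecAny.Any P y
    lookup⁺ (_ ∷ _) Fin.zero    Py = VecAny.here Py
    lookup⁺ (_ ∷ y) (Fin.suc i) Py = VecAny.there (lookup⁺ y i Py)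

  Any-⊗⁻ : ∀ {p a b} {P : ℂ → Set p} {x : Vec ℂ a} {y : Vec ℂ b} →
           VecAny.Any P (x ⊗ y) → VecAny.Any (λ s → ∃ λ i → P (s * Vec.lookup y i)) x
  Any-⊗⁻ any = VecAny.map (λ any → VecAny.index (VecAny.map⁻ any) , VecAny.lookup-index (VecAny.map⁻ any))
    (VecAny.map⁻ (VecAny.concat⁻ _ any))

  -- A choice of one index per vector, together with the product of the chosen entries up to `≈`.
  -- The indices are recorded because they are the exponents of the roots of unity.
  data ∏∈ : ∀ {t} {d : Vector ℕ t} → (∀ j → Vec ℂ (d j)) → ℂ → Set (c ⊔ ℓ₁) where
    nil  : ∀ {d : Vector ℕ 0} {v : ∀ j → Vec ℂ (d j)} {u} → u ≈ 1ℂ → ∏∈ v u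
    cons : ∀ {t} {d : Vector ℕ (suc t)} {v : ∀ j → Vec ℂ (d j)} {u u′} i →
           u ≈ Vec.lookup (v Fin.zero) i * u′ → ∏∈ (λ j → v (Fin.suc j)) u′ → ∏∈ v u

  -- The product associates to the left, so the recursion moves each vector into the accumulator
  -- `x`. The claim is therefore made for every `x`, with the factors still to come collected in
  -- `u`.
  ∈-⨂⁺ : ∀ {t a} {d : Vector ℕ t} {x : Vec ℂ a} {v : ∀ j → Vec ℂ (d j)} {z u} →
          ∏∈ v u → VecAny.Any (λ s → z ≈ s * u) x → z ∈ (x ⨂ v)
  ∈-⨂⁺ (nil u≈1) any =
    VecAny.map (λ z≈su → trans z≈su (trans (*-congˡ u≈1) (*-identityʳ _))) any
  ∈-⨂⁺ (cons i u≈ ∏u′) any = ∈-⨂⁺ ∏u′ (Any-⊗⁺ (VecAny.map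
    (λ z≈su → i , trans z≈su (trans (*-congˡ u≈) (sym (*-assoc _ _ _)))) any))

  ∈-⨂⁻ : ∀ {t a} {d : Vector ℕ t} {x : Vec ℂ a} (v : ∀ j → Vec ℂ (d j)) {z} →
          z ∈ (x ⨂ v) → VecAny.Any (λ s → ∃ λ u → ∏∈ v u × z ≈ s * u) x
  ∈-⨂⁻ {zero}  v z∈ = VecAny.map (λ z≈s → 1ℂ , nil refl , trans z≈s (sym (*-identityʳ _))) z∈
  ∈-⨂⁻ {suc t} v z∈ = VecAny.map
    (λ (i , u′ , ∏u′ , z≈) → _ , cons i refl ∏u′ , trans z≈ (*-assoc _ _ _))
    (Any-⊗⁻ (∈-⨂⁻ (λ j → v (Fin.suc j)) z∈))

-- Evaluation of products of linear factors.

module PolynomialEvaluation {c ℓ₁ ℓ₂} (R : RealNumbers c ℓ₁ ℓ₂) where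
  open ComplexNumbers R
  open ComplexField R using (commutativeRing; heytingField)
  open CommutativeRing commutativeRing
    using (setoid; sym; trans; +-cong; +-congˡ; *-cong; *-congˡ; +-identityˡ; +-identityʳ; zeroˡ; zeroʳ)
  open HeytingFieldProperties heytingField using (∏[_-_])
  open Identities commutativeRing
  open SetoidReasoning setoid

  opaque
    eval-+ₚ : ∀ p q z → eval (p +ₚ q) z ≈ eval p z + eval q z
    eval-+ₚ []      q       z = sym (+-identityˡ _)
    eval-+ₚ (a ∷ p) []      z = sym (+-identityʳ _)
    eval-+ₚ (a ∷ p) (b ∷ q) z = trans (+-congˡ (*-congˡ (eval-+ₚ p q z)))
      (horner-+ a b z (eval p z) (eval q z))

    eval-scale : ∀ a q z → eval (List.map (a *_) q) z ≈ a * eval q z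
    eval-scale a []      z = sym (zeroʳ a)
    eval-scale a (b ∷ q) z = trans (+-congˡ (*-congˡ (eval-scale a q z)))
      (horner-scale a b z (eval q z))

    eval-*ₚ : ∀ p q z → eval (p *ₚ q) z ≈ eval p z * eval q z
    eval-*ₚ []      q z = sym (zeroˡ _)
    eval-*ₚ (a ∷ p) q z = begin
      eval (List.map (a *_) q +ₚ (0ℂ ∷ p *ₚ q)) z
        ≈⟨ eval-+ₚ (List.map (a *_) q) (0ℂ ∷ p *ₚ q) z ⟩
      eval (List.map (a *_) q) z + (0ℂ + z * eval (p *ₚ q) z)
        ≈⟨ +-cong (eval-scale a q z) (+-congˡ (*-congˡ (eval-*ₚ p q z))) ⟩
      a * eval q z + (0ℂ + z * (eval p z * eval q z))
        ≈⟨ horner-* a z (eval p z) (eval q z) ⟩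
      (a + z * eval p z) * eval q z ∎

    eval-linearFactors : ∀ (f : ℕ → ℂ) js z →
      eval (List.foldr _*ₚ_ (1ℂ ∷ []) (List.map (λ j → - f j ∷ 1ℂ ∷ []) js)) z
        ≈ ∏[ z - List.map f js ]
    eval-linearFactors f []       z = trans (+-congˡ (zeroʳ z)) (+-identityʳ 1ℂ)
    eval-linearFactors f (j ∷ js) z =
      trans (eval-*ₚ (- f j ∷ 1ℂ ∷ []) (List.foldr _*ₚ_ (1ℂ ∷ []) (List.map (λ j → - f j ∷ 1ℂ ∷ []) js)) z)
        (*-cong (horner-linear (f j) z) (eval-linearFactors f js z))

-- Roots of cyclotomic polynomials as components of the Kronecker product.

module CyclotomicRoots {c ℓ₁ ℓ₂} (R : RealNumbers c ℓ₁ ℓ₂)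
  (exp : ComplexNumbers.ℂ R → ComplexNumbers.ℂ R) (isExp : ComplexNumbers.IsExp R exp)
  (π : RealNumbers.Carrier R) (isPi : ComplexNumbers.IsPi R exp π) where
  open ComplexNumbers R
  open Trigonometry R exp isExp π isPi
  open ComplexField R using (commutativeRing; heytingField)
  open HeytingField heytingField using (_#_; #-sym)
  open RootsOfUnity exp π
  open KroneckerProduct R
  open PolynomialEvaluation R
  open PrimeProducts
  private
    module ℂ where
      open CommutativeRing commutativeRing public
      open CommutativeExp commutativeSemiring public
        using (^-distrib-*; ^-congˡ; ^-congʳ; ^-homo-*; ^-assocʳ)
      open HeytingFieldProperties heytingField public
  open ℂ using (_-_)
  open Identities commutativeRing
  open SetoidReasoning ℂ.setoid

  1^n≈1 : ∀ n → 1ℂ ^ n ≈ 1ℂ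
  1^n≈1 zero    = ℂ.refl
  1^n≈1 (suc n) = ℂ.trans (ℂ.*-identityˡ _) (1^n≈1 n)

  ζ#0 : ∀ n .{{_ : ℕ.NonZero n}} → ζ n # 0ℂ
  ζ#0 n = ℂ.^-#0⁻ n (ℂ.#-congʳ (ℂ.sym (ζ^n≈1 n)) ℂ.1#0)

  ζ^[nq]≈1 : ∀ n q .{{_ : ℕ.NonZero n}} → ζ n ^ (n ℕ.* q) ≈ 1ℂ
  ζ^[nq]≈1 n q = ℂ.trans (ℂ.sym (ℂ.^-assocʳ (ζ n) n q))
    (ℂ.trans (ℂ.^-congˡ q (ζ^n≈1 n)) (1^n≈1 q))

  ζ^-periodic : ∀ n r q .{{_ : ℕ.NonZero n}} → ζ n ^ (r ℕ.+ q ℕ.* n) ≈ ζ n ^ r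
  ζ^-periodic n r q = begin
    ζ n ^ (r ℕ.+ q ℕ.* n)         ≈⟨ ℂ.^-homo-* (ζ n) r _ ⟩
    ζ n ^ r * ζ n ^ (q ℕ.* n)     ≡⟨ ≡.cong (λ e → ζ n ^ r * ζ n ^ e) (ℕ.*-comm q n) ⟩
    ζ n ^ r * ζ n ^ (n ℕ.* q)     ≈⟨ ℂ.*-congˡ (ζ^[nq]≈1 n q) ⟩
    ζ n ^ r * 1ℂ                  ≈⟨ ℂ.*-identityʳ _ ⟩
    ζ n ^ r                       ∎

  -- The difference factors as `ζ n ^ i * (ζ n ^ (j ∸ i) - 1ℂ)`, and both factors are apart from 0.
  ζ^-# : ∀ n {i j} → i ℕ.< j → j ℕ.< n → ζ n ^ i # ζ n ^ j
  ζ^-# n {i} {j} i<j j<n = #-sym (ℂ.-#0⇒# (ℂ.#-congʳ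
    (begin
      ζ n ^ i * (ζ n ^ (j ℕ.∸ i) - 1ℂ)   ≈⟨ factor-difference (ζ n ^ i) _ ⟩
      ζ n ^ i * ζ n ^ (j ℕ.∸ i) - ζ n ^ i ≈⟨ ℂ.+-congʳ (ℂ.^-homo-* (ζ n) i (j ℕ.∸ i)) ⟨
      ζ n ^ (i ℕ.+ (j ℕ.∸ i)) - ζ n ^ i  ≡⟨ ≡.cong (λ e → ζ n ^ e - ζ n ^ i) (ℕ.m+[n∸m]≡n (ℕ.<⇒≤ i<j)) ⟩
      ζ n ^ j - ζ n ^ i                  ∎)
    (ℂ.x#0y#0→xy#0 (ℂ.^-#0 i (ζ#0 n))
      (ℂ.#⇒-#0 (ζ^j#1 n (j ℕ.∸ i) (ℕ.m<n⇒0<n∸m i<j) (ℕ.≤-<-trans (ℕ.m∸n≤m j i) j<n))))))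
    where
    instance
      n≢0 : ℕ.NonZero n
      n≢0 = ℕ.>-nonZero (ℕ.≤-<-trans ℕ.z≤n j<n)

  -- The powers of `ζ n` below n are n pairwise apart roots of X^n - 1, hence all of them.
  z^n≈1⇒z≈ζ^j : ∀ n .{{_ : ℕ.NonZero n}} {z} → z ^ n ≈ 1ℂ → ∃ λ (j : Fin n) → z ≈ ζ n ^ toℕ j
  z^n≈1⇒z≈ζ^j n {z} z^n≈1 =
    let j , j<n , z≈ = Any.applyUpTo⁻ (λ j → j) (Any.map⁻ z∈) in
    Fin.fromℕ< j<n , ℂ.trans z≈ (ℂ.^-congʳ (ζ n) (≡.sym (Fin.toℕ-fromℕ< j<n)))
    where
    z∈ : Any (z ≈_) (List.map (ζ n ^_) (List.upTo n))
    z∈ = ℂ.rootOfUnity∈ n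
      (≡.trans (List.length-map (ζ n ^_) (List.upTo n)) (List.length-upTo n))
      (AllPairs.map⁺ (AllPairs.applyUpTo⁺₁ (λ j → j) n (ζ^-# n)))
      (All.map⁺ (All.applyUpTo⁺₂ (λ j → j) n λ j → begin
        (ζ n ^ j) ^ n       ≈⟨ ℂ.^-assocʳ (ζ n) j n ⟩
        ζ n ^ (j ℕ.* n)     ≡⟨ ≡.cong (ζ n ^_) (ℕ.*-comm j n) ⟩
        ζ n ^ (n ℕ.* j)     ≈⟨ ζ^[nq]≈1 n j ⟩
        1ℂ                  ∎))
      z^n≈1

  primitiveExponents : ℕ → List ℕ
  primitiveExponents n = List.filter (λ j → coprime? j n) (List.upTo n)

  Φ-root⇒ : ∀ n {w} → eval (Φ n) w ≈ 0ℂ → ∃ λ r → Coprime r n × w ≈ ζ n ^ r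
  Φ-root⇒ n {w} Φ≈0 =
    let r , r∈ , w≈ = Membership.find (Any.map⁻ w∈) in
    r , proj₂ (Membership.∈-filter⁻ (λ j → coprime? j n) {xs = List.upTo n} r∈) , w≈
    where
    w∈ : Any (w ≈_) (List.map (ζ n ^_) (primitiveExponents n))
    w∈ = ℂ.∏≈0⇒∈
      (AllPairs.map⁺ (AllPairs.filter⁺ (λ j → coprime? j n) (AllPairs.applyUpTo⁺₁ (λ j → j) n (ζ^-# n))))
      (ℂ.trans (ℂ.sym (eval-linearFactors (ζ n ^_) (primitiveExponents n) w)) Φ≈0)

  -- The exponents produced by `combine-coprime` may exceed n, whereas `Φ` lists those below n, so
  -- `r` is first reduced modulo `n`.
  Φ-root⇐ : ∀ n r .{{_ : ℕ.NonZero n}} {w} → Coprime r n → w ≈ ζ n ^ r → eval (Φ n) w ≈ 0ℂ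
  Φ-root⇐ n r {w} r⊥n w≈ = ℂ.trans (eval-linearFactors (ζ n ^_) (primitiveExponents n) w)
    (ℂ.∈⇒∏≈0 (Any.map⁺ (Membership.lose
      (Membership.∈-filter⁺ (λ j → coprime? j n) (Membership.∈-upTo⁺ (DivMod.m%n<n r n)) r%n⊥n)
      (ℂ.trans w≈ (ℂ.trans (ℂ.^-congʳ (ζ n) r≡) (ζ^-periodic n (r DivMod.% n) (r DivMod./ n)))))))
    where
    r≡ : r ≡ r DivMod.% n ℕ.+ r DivMod./ n ℕ.* n
    r≡ = DivMod.m≡m%n+[m/n]*n r n
    r%n⊥n : Coprime (r DivMod.% n) n
    r%n⊥n (d∣r%n , d∣n) =
      r⊥n (∣-respʳ (≡.sym r≡) (∣.∣m∣n⇒∣m+n d∣r%n (∣.∣n⇒∣m*n (r DivMod./ n) d∣n)) , d∣n)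

  ζ-* : ∀ m n i s .{{_ : ℕ.NonZero m}} .{{_ : ℕ.NonZero n}} →
        ζ (m ℕ.* n) ^ (i ℕ.* n ℕ.+ s ℕ.* m) ≈ ζ m ^ i * ζ n ^ s
  ζ-* m n i s = begin
    ζ mn ^ (i ℕ.* n ℕ.+ s ℕ.* m)             ≈⟨ ℂ.^-homo-* (ζ mn) (i ℕ.* n) (s ℕ.* m) ⟩
    ζ mn ^ (i ℕ.* n) * ζ mn ^ (s ℕ.* m)      ≡⟨ ≡.cong₂ (λ d e → ζ mn ^ d * ζ mn ^ e) (ℕ.*-comm i n) (ℕ.*-comm s m) ⟩
    ζ mn ^ (n ℕ.* i) * ζ mn ^ (m ℕ.* s)      ≈⟨ ℂ.*-cong (ℂ.^-assocʳ (ζ mn) n i) (ℂ.^-assocʳ (ζ mn) m s) ⟨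
    (ζ mn ^ n) ^ i * (ζ mn ^ m) ^ s          ≡⟨ ≡.cong (λ d → (ζ d ^ n) ^ i * (ζ mn ^ m) ^ s) (ℕ.*-comm m n) ⟩
    (ζ (n ℕ.* m) ^ n) ^ i * (ζ mn ^ m) ^ s   ≈⟨ ℂ.*-cong (ℂ.^-congˡ i (ζ[m*n]^m≈ζn n m)) (ℂ.^-congˡ s (ζ[m*n]^m≈ζn m n)) ⟩
    ζ m ^ i * ζ n ^ s                        ∎
    where
    mn : ℕ
    mn = m ℕ.* n

  ζ*-entry-0< : ∀ {p} (j : Fin p) → 0 ℕ.< toℕ j → ζ*-entry p j ≡ ζ p ^ toℕ j
  ζ*-entry-0< (Fin.suc j) 0<j = ≡.refl

  -- The index settles a case distinction that could not be made on complex numbers.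
  ζ*-entry-cases : ∀ {p} (j : Fin p) → ζ*-entry p j ≡ 0ℂ ⊎ 0 ℕ.< toℕ j
  ζ*-entry-cases Fin.zero    = inj₁ ≡.refl
  ζ*-entry-cases (Fin.suc j) = inj₂ (ℕ.s≤s ℕ.z≤n)

  module _ (k : ℕ) .{{_ : ℕ.NonZero k}} where

    Roots : ∀ {t} (p : Vector ℕ t) → (∀ j → Vec ℂ (p j)) → Set ℓ₁
    Roots p v = ∀ j i → Vec.lookup (v j) i ^ k ≈ ζ*-entry (p j) i

    -- A nonzero product has no zero factor, so all chosen indices are positive, and
    -- `combine-coprime` assembles them into one exponent prime to the product of the primes.
    ∏∈⇒ζ : ∀ {t} (p : Vector ℕ t) v → (∀ j → Prime (p j)) → Injective _≡_ _≡_ p → Roots p v →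
           ∀ {u} → ∏∈ v u → ¬ u ≈ 0ℂ → ∃ λ r → Coprime r (∏ p) × u ^ k ≈ ζ (∏ p) ^ r
    ∏∈⇒ζ {zero}  p v p-prime p-inj v-roots (nil u≈1) u≉0 =
      0 , (λ (_ , d∣1) → ∣.∣1⇒≡1 d∣1) , ℂ.trans (ℂ.^-congˡ k u≈1) (1^n≈1 k)
    ∏∈⇒ζ {suc t} p v p-prime p-inj v-roots {u} (cons {u′ = u′} i u≈ ∏u′) u≉0
      with ζ*-entry-cases i
         | ∏∈⇒ζ (p ∘ Fin.suc) (λ j → v (Fin.suc j)) (p-prime ∘ Fin.suc) (Fin.suc-injective ∘ p-inj)
             (λ j → v-roots (Fin.suc j)) ∏u′ (λ u′≈0 → u≉0 (ℂ.trans u≈ (ℂ.trans (ℂ.*-congˡ u′≈0) (ℂ.zeroʳ _))))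
    -- The `k`th power of the chosen component is 0, so the component itself is 0 and `u` would
    -- vanish.
    ... | inj₁ entry≡0 | _ = contradiction
      (ℂ.trans u≈ (ℂ.trans (ℂ.*-congʳ
        (ℂ.x^n≈0⇒x≈0 k (ℂ.trans (v-roots Fin.zero i) (ℂ.reflexive entry≡0)))) (ℂ.zeroˡ _)))
      u≉0
    ... | inj₂ 0<i | s , s⊥m , u′^k≈ =
      toℕ i ℕ.* m ℕ.+ s ℕ.* q ,
      combine-coprime (p-prime Fin.zero) (head-coprime p p-prime p-inj) 0<i (Fin.toℕ<n i) s⊥m ,
      (begin
        u ^ k                                      ≈⟨ ℂ.^-congˡ k u≈ ⟩
        (Vec.lookup (v Fin.zero) i * u′) ^ k       ≈⟨ ℂ.^-distrib-* _ _ k ⟩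
        Vec.lookup (v Fin.zero) i ^ k * u′ ^ k     ≈⟨ ℂ.*-cong (v-roots Fin.zero i) u′^k≈ ⟩
        ζ*-entry q i * ζ m ^ s                     ≡⟨ ≡.cong (_* ζ m ^ s) (ζ*-entry-0< i 0<i) ⟩
        ζ q ^ toℕ i * ζ m ^ s                      ≈⟨ ζ-* q m (toℕ i) s ⟨
        ζ (q ℕ.* m) ^ (toℕ i ℕ.* m ℕ.+ s ℕ.* q)    ∎)
      where
      q m : ℕ
      q = p Fin.zero
      m = ∏ (p ∘ Fin.suc)
      instance
        q≢0 : ℕ.NonZero q
        q≢0 = prime⇒nonZero (p-prime Fin.zero)
        m≢0 : ℕ.NonZero m
        m≢0 = ∏-nonZero (p ∘ Fin.suc) (p-prime ∘ Fin.suc)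

    -- The residue of the exponent belonging to the first prime selects the entry of the first
    -- vector; the remaining exponent `s` is again prime to the remaining product and is treated by
    -- recursion.
    ζ⇒∏∈ : ∀ {t} (p : Vector ℕ t) v → (∀ j → Prime (p j)) → Injective _≡_ _≡_ p → Roots p v →
           ∀ r → Coprime r (∏ p) → ∃ λ u → ∏∈ v u × u ^ k ≈ ζ (∏ p) ^ r
    ζ⇒∏∈ {zero}  p v p-prime p-inj v-roots r r⊥1 =
      1ℂ , nil ℂ.refl , ℂ.trans (1^n≈1 k) (ℂ.sym (ℂ.trans (ℂ.^-congˡ r ζ1≈1) (1^n≈1 r)))
      where
      ζ1≈1 : ζ 1 ≈ 1ℂ
      ζ1≈1 = ℂ.trans (ℂ.sym (ℂ.*-identityʳ _)) (ζ^n≈1 1)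
    ζ⇒∏∈ {suc t} p v p-prime p-inj v-roots r r⊥n =
      let i , s , 0<i , i<q , s⊥m , c , im+sq≡ =
            split-coprime q m r (p-prime Fin.zero) (head-coprime p p-prime p-inj) r⊥n
          u′ , ∏u′ , u′^k≈ = ζ⇒∏∈ (p ∘ Fin.suc) (λ j → v (Fin.suc j)) (p-prime ∘ Fin.suc)
            (Fin.suc-injective ∘ p-inj) (λ j → v-roots (Fin.suc j)) s s⊥m
          j       = Fin.fromℕ< i<q
          toℕj≡i  = Fin.toℕ-fromℕ< i<q
      in
      Vec.lookup (v Fin.zero) j * u′ , cons j ℂ.refl ∏u′ , (begin
        (Vec.lookup (v Fin.zero) j * u′) ^ k     ≈⟨ ℂ.^-distrib-* _ _ k ⟩
        Vec.lookup (v Fin.zero) j ^ k * u′ ^ k   ≈⟨ ℂ.*-cong (v-roots Fin.zero j) u′^k≈ ⟩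
        ζ*-entry q j * ζ m ^ s                   ≡⟨ ≡.cong (_* ζ m ^ s)
                                                      (ζ*-entry-0< j (≡.subst (0 ℕ.<_) (≡.sym toℕj≡i) 0<i)) ⟩
        ζ q ^ toℕ j * ζ m ^ s                    ≡⟨ ≡.cong (λ e → ζ q ^ e * ζ m ^ s) toℕj≡i ⟩
        ζ q ^ i * ζ m ^ s                        ≈⟨ ζ-* q m i s ⟨
        ζ (q ℕ.* m) ^ (i ℕ.* m ℕ.+ s ℕ.* q)      ≡⟨ ≡.cong (ζ (q ℕ.* m) ^_) im+sq≡ ⟩
        ζ (q ℕ.* m) ^ (r ℕ.+ c ℕ.* (q ℕ.* m))    ≈⟨ ζ^-periodic (q ℕ.* m) r c {{ℕ.m*n≢0 q m}} ⟩
        ζ (q ℕ.* m) ^ r                          ∎)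
      where
      q m : ℕ
      q = p Fin.zero
      m = ∏ (p ∘ Fin.suc)
      instance
        q≢0 : ℕ.NonZero q
        q≢0 = prime⇒nonZero (p-prime Fin.zero)
        m≢0 : ℕ.NonZero m
        m≢0 = ∏-nonZero (p ∘ Fin.suc) (p-prime ∘ Fin.suc)

    principalRoots⇒Roots : ∀ {t} (p : Vector ℕ t) (v : ∀ j → Vec ℂ (p j)) →
      (∀ j → IsPrincipalRootVec k (ζ⃗* (p j)) (v j)) → Roots p v
    principalRoots⇒Roots p v v-principal j i = ℂ.trans
      (principalRoot^k (Pointwise.lookup (v-principal j) i))
      (ℂ.reflexive (Vec.lookup∘tabulate (ζ*-entry (p j)) i))

    -- The quotient of `z` by `u` is a `k`th root of unity. Apartness of `u` from 0, rather than
    -- mere inequality, provides the inverse.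
    z^k≈u^k⇒z≈ζ^a*u : ∀ {z u} → z ^ k ≈ u ^ k → u # 0ℂ → ∃ λ (a : Fin k) → z ≈ ζ k ^ toℕ a * u
    z^k≈u^k⇒z≈ζ^a*u {z} {u} z^k≈u^k u#0 = divide (ℂ.inverse u#0)
      where
      divide : (∃ λ y → u * y ≈ 1ℂ) → ∃ λ (a : Fin k) → z ≈ ζ k ^ toℕ a * u
      divide (y , uy≈1) = multiply (z^n≈1⇒z≈ζ^j k (begin
        (z * y) ^ k         ≈⟨ ℂ.^-distrib-* z y k ⟩
        z ^ k * y ^ k       ≈⟨ ℂ.*-congʳ z^k≈u^k ⟩
        u ^ k * y ^ k       ≈⟨ ℂ.^-distrib-* u y k ⟨
        (u * y) ^ k         ≈⟨ ℂ.^-congˡ k uy≈1 ⟩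
        1ℂ ^ k              ≈⟨ 1^n≈1 k ⟩
        1ℂ                  ∎))
        where
        multiply : (∃ λ (a : Fin k) → z * y ≈ ζ k ^ toℕ a) → ∃ λ (a : Fin k) → z ≈ ζ k ^ toℕ a * u
        multiply (a , zy≈ζ^a) = a , (begin
          z                   ≈⟨ ℂ.*-identityʳ z ⟨
          z * 1ℂ              ≈⟨ ℂ.*-congˡ (ℂ.trans (ℂ.*-comm y u) uy≈1) ⟨
          z * (y * u)         ≈⟨ ℂ.*-assoc z y u ⟨
          z * y * u           ≈⟨ ℂ.*-congʳ zy≈ζ^a ⟩
          ζ k ^ toℕ a * u     ∎)

    module _ {t} (p : Vector ℕ t) (v : ∀ j → Vec ℂ (p j)) (p-prime : ∀ j → Prime (p j))
      (p-inj : Injective _≡_ _≡_ p) (v-roots : Roots p v) where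

      private instance
        n≢0 : ℕ.NonZero (∏ p)
        n≢0 = ∏-nonZero p p-prime

      Φ-root⇒component : ∀ z → eval (Φ (∏ p)) (z ^ k) ≈ 0ℂ → z ∈ (ζ⃗ k ⨂ v) × ¬ z ≈ 0ℂ
      Φ-root⇒component z Φ≈0 = exponent (Φ-root⇒ (∏ p) Φ≈0)
        where
        component : ∀ r → z ^ k ≈ ζ (∏ p) ^ r → (∃ λ u → ∏∈ v u × u ^ k ≈ ζ (∏ p) ^ r) →
                    z ∈ (ζ⃗ k ⨂ v)
        component r z^k≈ζ^r (u , ∏u , u^k≈ζ^r) =
          ∈-⨂⁺ ∏u (uncurry VecAny.tabulate⁺ (z^k≈u^k⇒z≈ζ^a*u
            (ℂ.trans z^k≈ζ^r (ℂ.sym u^k≈ζ^r))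
            -- `u ^ k` is a power of the invertible number `ζ (∏ p)`, so `u` is apart from 0.
            (ℂ.^-#0⁻ k (ℂ.#-congʳ (ℂ.sym u^k≈ζ^r) (ℂ.^-#0 r (ζ#0 (∏ p)))))))

        exponent : (∃ λ r → Coprime r (∏ p) × z ^ k ≈ ζ (∏ p) ^ r) → z ∈ (ζ⃗ k ⨂ v) × ¬ z ≈ 0ℂ
        exponent (r , r⊥n , z^k≈ζ^r) =
          component r z^k≈ζ^r (ζ⇒∏∈ p v p-prime p-inj v-roots r r⊥n) ,
          ℂ.#⇒≉ (ℂ.^-#0⁻ k (ℂ.#-congʳ (ℂ.sym z^k≈ζ^r) (ℂ.^-#0 r (ζ#0 (∏ p)))))

      component⇒Φ-root : ∀ z → z ∈ (ζ⃗ k ⨂ v) × ¬ z ≈ 0ℂ → eval (Φ (∏ p)) (z ^ k) ≈ 0ℂ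
      component⇒Φ-root z (z∈ , z≉0) = root (VecAny.tabulate⁻ (∈-⨂⁻ v z∈))
        where
        root : (∃ λ (a : Fin k) → ∃ λ u → ∏∈ v u × z ≈ ζ k ^ toℕ a * u) → eval (Φ (∏ p)) (z ^ k) ≈ 0ℂ
        root (a , u , ∏u , z≈ζ^a*u) = exponent (∏∈⇒ζ p v p-prime p-inj v-roots ∏u
            (λ u≈0 → z≉0 (ℂ.trans z≈ζ^a*u (ℂ.trans (ℂ.*-congˡ u≈0) (ℂ.zeroʳ _)))))
          where
          exponent : (∃ λ r → Coprime r (∏ p) × u ^ k ≈ ζ (∏ p) ^ r) → eval (Φ (∏ p)) (z ^ k) ≈ 0ℂ
          exponent (r , r⊥n , u^k≈ζ^r) = Φ-root⇐ (∏ p) r r⊥n (begin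
            z ^ k                              ≈⟨ ℂ.^-congˡ k z≈ζ^a*u ⟩
            (ζ k ^ toℕ a * u) ^ k              ≈⟨ ℂ.^-distrib-* _ u k ⟩
            (ζ k ^ toℕ a) ^ k * u ^ k          ≈⟨ ℂ.*-cong (ℂ.^-assocʳ (ζ k) (toℕ a) k) u^k≈ζ^r ⟩
            -- The exponent is `0 + toℕ a * k`, so periodicity leaves `ζ k ^ 0`, which is `1ℂ` by
            -- definition.
            ζ k ^ (toℕ a ℕ.* k) * ζ (∏ p) ^ r  ≈⟨ ℂ.*-congʳ (ζ^-periodic k 0 (toℕ a)) ⟩
            1ℂ * ζ (∏ p) ^ r                   ≈⟨ ℂ.*-identityˡ _ ⟩
            ζ (∏ p) ^ r                        ∎)

open import Data.Nat using (_≤_; NonZero)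

proposition1p9 : ∀ {c ℓ₁ ℓ₂} (R : RealNumbers c ℓ₁ ℓ₂) →
    let open ComplexNumbers R in
    ∀ (exp : ℂ → ℂ) → IsExp exp →
    ∀ (π : RealNumbers.Carrier R) → IsPi exp π →
    let open RootsOfUnity exp π in
    ∀ (t : ℕ) (p : Vector ℕ t) →
    (∀ j → Prime (p j)) → Injective _≡_ _≡_ p →
    ∀ (n : ℕ) → n ≡ foldr ℕ._*_ 1 p → 2 ≤ n →
    ∀ (k : ℕ) .{{_ : NonZero k}} →
    (∀ j → ∃ λ v → IsPrincipalRootVec k (ζ⃗* (p j)) v) ×
    (∀ (v : (j : Fin t) → Vec ℂ (p j)) →
    (∀ j → IsPrincipalRootVec k (ζ⃗* (p j)) (v j)) →
    ∀ z → (eval (Φ n) (z ^ k) ≈ 0ℂ) ⇔ ((z ∈ (ζ⃗ k ⨂ v)) × ¬ (z ≈ 0ℂ)))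
proposition1p9 R exp isExp π isPi t p p-prime p-inj n ≡.refl 2≤n k =
  (λ j → principalRootVec-ζ* k (p j)) ,
  (λ v v-principal z →
    let v-roots = principalRoots⇒Roots k p v v-principal in
    mk⇔ (Φ-root⇒component k p v p-prime p-inj v-roots z)
        (component⇒Φ-root k p v p-prime p-inj v-roots z))
  where
  open Trigonometry R exp isExp π isPi using (principalRootVec-ζ*)
  open CyclotomicRoots R exp isExp π isPi
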